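{- Fix an injective computable enumeration $q_0,q_1,\dots$ of $\mathbb Q\cap(1,2)$. Define $u_i(k)=q_i$ for all $i,k\in\mathbb N$, and let $D=\{(i,j)\in\mathbb N^2:q_i>q_j\}$. Then there exist a set $A\subseteq\mathbb N$ with $A\le_T\emptyset'$ and a uniformly computable family of total surjective functions $h_i:\mathbb N\to\mathbb N$ ($i\in\mathbb N$) forming a profile coding for $(\{u_i\}_{i\in\mathbb N},D)$, such that, with $B_{q_i}=C_i$ where $C_i(x)=A(h_i(x))$, one has $$B_{q_i}\equiv_{\rm bfo}A\quad\text{for every }i\in\mathbb N,$$ and for all $i,j\in\mathbb N$ $$B_{q_i}<_1 B_{q_j}\quad\text{if and only if}\quad q_i<q_j.$$ Hence the $1$-degrees inside the bounded finite-one degree of $A$ contain a copy of $(\mathbb Q,\le)$.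
   Context: Sets $A\subseteq\mathbb N=\{0,1,\dots\}$ are identified with their characteristic functions: $A(x)=1$ if $x\in A$, $A(x)=0$ otherwise. $\emptyset'$ is the Turing jump of the empty set. A family of functions $h_i$ is uniformly computable if $(i,x)\mapsto h_i(x)$ is computable. For $A,B\subseteq\mathbb N$: $A\le_1 B$ means there is a total computable injective $f:\mathbb N\to\mathbb N$ with $x\in A\iff f(x)\in B$ for all $x$. $A\le_{\rm bfo}B$ means there are a total computable $f:\mathbb N\to\mathbb N$ and a constant $c\ge1$ with $x\in A\iff f(x)\in B$ for all $x$ and $|f^{ -1}(y)|\le c$ for all $y$. For $r\in\{1,{\rm bfo}\}$, $A\equiv_r B$ means $A\le_r B$ and $B\le_r A$; $A<_r B$ means $A\le_r B$ and $B\not\le_r A$. The equivalence classes of $\equiv_1$ are the $1$-degrees, those of $\equiv_{\rm bfo}$ the bounded finite-one degrees. Since $\le_1$ implies $\le_{\rm bfo}$, each bounded finite-one degree is a union of $1$-degrees; these are partially ordered by $\deg_1(X)\le\deg_1(Y)\iff X\le_1 Y$. "Contains a copy of" a partial order means that there is an order-embedding (preserving and reflecting $\le$) of it into this poset. Block-density profiles are functions $u:\mathbb N\to\mathbb Q\cap(1,2)$. Given a family of profiles $\{u_i\}_{i\in\mathbb N}$ and $D\subseteq\mathbb N^2$, say that $A$ and $(h_i)_{i\in\mathbb N}$ form a profile coding for $(\{u_i\},D)$ if, with $a_0=0$, $a_{k+1}=a_k+k!$, $I_k=[a_k,a_{k+1})$ and $C_i(x)=A(h_i(x))$: (a) $A$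 is constant on each $I_k$; (b) $|h_i^{ -1}(y)|\le2$ for all $i,y$; (c) $C_i\equiv_{\rm bfo}A$ for all $i$; (d) if $u_i(k)\le u_j(k)$ for all $k$, then $C_i\le_1 C_j$; (e) if $(i,j)\in D$, then $C_i\not\le_1 C_j$. -}

module Defs where

open import Level using (0ℓ; _⊔_) renaming (suc to lsuc)
open import Data.Nat.Base using (ℕ; zero; suc; _+_; _*_; _≤_; _<_; _≥_; _!)
open import Data.Fin.Base using (Fin; toℕ) renaming (zero to fzero)
open import Data.Integer.Base as ℤ using (ℤ; +_; -1ℤ)
open import Data.Rational.Base as ℚ using (ℚ; 1ℚ)
open import Data.Rational.Properties using (≤-decTotalOrder)
open import Data.List.Base using (List; length)
open import Data.List.Relation.Unary.All using (All)
open import Data.List.Relation.Unary.Unique.Propositional using (Unique)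
open import Data.Vec.Base using (Vec; []; _∷_; lookup)
open import Data.Vec.Relation.Binary.Pointwise.Inductive using (Pointwise; []; _∷_)
open import Data.Product.Base using (∃-syntax; Σ-syntax; _×_; _,_; proj₁; proj₂; swap)
open import Data.Refinement.Base using (Refinement-syntax; value)
open import Function.Base using (id; _∘_; _on_)
open import Function.Bundles using (_⇔_)
open import Function.Definitions using (Injective)
open import Function.Construct.Identity using (⇔-id)
open import Function.Construct.Composition using (_⇔-∘_)
open import Relation.Nullary.Negation.Core using (¬_)
open import Relation.Unary using (Pred; _∈_; _∉_; ∅; _⊢_)
open import Relation.Binary.Bundles using (Poset; DecTotalOrder)
open import Relation.Binary.Morphism.Structures using (IsOrderMonomorphism)
open import Relation.Binary.PropositionalEquality.Core using (_≡_; refl)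

-- Membership in a subset of ℕ need not be decidable in Agda, so subsets are
-- predicates and the characteristic function is given by its graph.
Subset : Set₁
Subset = Pred ℕ 0ℓ

data χ (X : Subset) (x : ℕ) : ℕ → Set where
  member    : x ∈ X → χ X x 1
  nonmember : x ∉ X → χ X x 0

------------------------------------------------------------------------
-- μ-recursive functions with an oracle

data Code : ℕ → Set where
  zer    : ∀ {n} → Code n
  succ   : Code 1
  oracle : Code 1
  proj   : ∀ {n} → Fin n → Code n
  comp   : ∀ {m n} → Code m → Vec (Code n) m → Code n
  prec   : ∀ {n} → Code n → Code (suc (suc n)) → Code (suc n)
  mini   : ∀ {n} → Code (suc n) → Code n

-- Eval X c xs v: program c with oracle X halts on input xs with output v.
-- The recursion variable of prec and the search variable of mini come first;
-- the second argument of the step function of prec is the previous value.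
data Eval (X : Subset) : ∀ {n} → Code n → Vec ℕ n → ℕ → Set where
  zer       : ∀ {n} {xs : Vec ℕ n} → Eval X zer xs 0
  succ      : ∀ {x} → Eval X succ (x ∷ []) (suc x)
  oracle    : ∀ {x v} → χ X x v → Eval X oracle (x ∷ []) v
  proj      : ∀ {n} {xs : Vec ℕ n} (i : Fin n) → Eval X (proj i) xs (lookup xs i)
  comp      : ∀ {m n} {f : Code m} {gs : Vec (Code n) m} {xs ys v} →
              Pointwise (λ g y → Eval X g xs y) gs ys →
              Eval X f ys v → Eval X (comp f gs) xs v
  prec-zero : ∀ {n} {f : Code n} {g xs v} →
              Eval X f xs v → Eval X (prec f g) (0 ∷ xs) v
  prec-suc  : ∀ {n} {f : Code n} {g xs k w v} →
              Eval X (prec f g) (k ∷ xs) w → Eval X g (k ∷ w ∷ xs) v →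
              Eval X (prec f g) (suc k ∷ xs) v
  mini      : ∀ {n} {f : Code (suc n)} {xs k} →
              (∀ {j} → j < k → ∃[ v ] Eval X f (j ∷ xs) (suc v)) →
              Eval X f (k ∷ xs) 0 → Eval X (mini f) xs k

-- Injective, because (a + b)² ≤ pair a b < (a + b + 1)².
pair : ℕ → ℕ → ℕ
pair a b = (a + b) * (a + b) + b

mutual
  ⌜_⌝ : ∀ {n} → Code n → ℕ
  ⌜ zer ⌝            = pair 0 0
  ⌜ succ ⌝           = pair 1 0
  ⌜ oracle ⌝         = pair 2 0
  ⌜ proj i ⌝         = pair 3 (toℕ i)
  ⌜ comp {m} f gs ⌝  = pair 4 (pair m (pair ⌜ f ⌝ ⌜ gs ⌝*))
  ⌜ prec f g ⌝       = pair 5 (pair ⌜ f ⌝ ⌜ g ⌝)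
  ⌜ mini f ⌝         = pair 6 ⌜ f ⌝

  ⌜_⌝* : ∀ {m n} → Vec (Code n) m → ℕ
  ⌜ [] ⌝*     = 0
  ⌜ g ∷ gs ⌝* = suc (pair ⌜ g ⌝ ⌜ gs ⌝*)

-- The jump {e ∣ Φₑ^X(e)↓}; numbers that are not the number of a unary
-- program index the nowhere defined function.
infix 10 _′
_′ : Subset → Subset
(X ′) e = Σ[ c ∈ Code 1 ] ⌜ c ⌝ ≡ e × (∃[ v ] Eval X c (e ∷ []) v)

-- The oracle ∅ only contributes a constant function, so programs with oracle ∅
-- compute exactly the (oracle-free) computable functions.
Computable : (ℕ → ℕ) → Set
Computable f = Σ[ c ∈ Code 1 ] ∀ x → Eval ∅ c (x ∷ []) (f x)

Computable₂ : (ℕ → ℕ → ℕ) → Set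
Computable₂ f = Σ[ c ∈ Code 2 ] ∀ x y → Eval ∅ c (x ∷ y ∷ []) (f x y)

-- r(i) = (-1)^{s(i)} n(i) / (d(i) + 1) with s, n, d computable.
Computableℚ : (ℕ → ℚ) → Set
Computableℚ r =
  ∃[ s ] ∃[ n ] ∃[ d ]
    Computable s × Computable n × Computable d ×
    (∀ i → r i ≡ ((-1ℤ ℤ.^ s i) ℤ.* + n i) ℚ./ suc (d i))

------------------------------------------------------------------------
-- Reducibilities

infix 4 _≤T_ _≤₁_ _≡₁_ _<₁_ _≤bfo_ _≡bfo_

_≤T_ : Subset → Subset → Set
A ≤T B = Σ[ c ∈ Code 1 ] ∀ {x v} → χ A x v → Eval B c (x ∷ []) v

Reduces : (ℕ → ℕ) → Subset → Subset → Set
Reduces f A B = ∀ x → x ∈ A ⇔ f x ∈ B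

-- |f⁻¹(y)| ≤ c for every y.
FibresBounded : (ℕ → ℕ) → ℕ → Set
FibresBounded f c =
  ∀ y (xs : List ℕ) → Unique xs → All (λ x → f x ≡ y) xs → length xs ≤ c

_≤₁_ : Subset → Subset → Set
A ≤₁ B = ∃[ f ] Computable f × Injective _≡_ _≡_ f × Reduces f A B

_≡₁_ : Subset → Subset → Set
A ≡₁ B = A ≤₁ B × B ≤₁ A

_<₁_ : Subset → Subset → Set
A <₁ B = A ≤₁ B × ¬ (B ≤₁ A)

_≤bfo_ : Subset → Subset → Set
A ≤bfo B =
  ∃[ f ] Computable f × (∃[ c ] c ≥ 1 × FibresBounded f c) × Reduces f A B

_≡bfo_ : Subset → Subset → Set
A ≡bfo B = A ≤bfo B × B ≤bfo A

≤₁-refl : ∀ A → A ≤₁ A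
≤₁-refl A = id , (proj fzero , λ x → proj fzero) , id , λ _ → ⇔-id _

≤₁-trans : ∀ A B C → A ≤₁ B → B ≤₁ C → A ≤₁ C
≤₁-trans A B C (f , (c , cf) , f-inj , f-red) (g , (d , dg) , g-inj , g-red) =
  g ∘ f
  , (comp d (c ∷ []) , λ x → comp (cf x ∷ []) (dg (f x)))
  , f-inj ∘ g-inj
  , λ x → g-red (f x) ⇔-∘ f-red x

-- The 1-degrees inside the bounded finite-one degree of A, as a poset whose
-- elements are representatives and whose equality is ≡₁.
OneDegreesIn : Subset → Poset (lsuc 0ℓ) 0ℓ 0ℓ
OneDegreesIn A = record
  { Carrier        = Σ[ X ∈ Subset ] X ≡bfo A
  ; _≈_            = _≡₁_ on proj₁
  ; _≤_            = _≤₁_ on proj₁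
  ; isPartialOrder = record
    { isPreorder = record
      { isEquivalence = record
        { refl  = λ { {X , _} → ≤₁-refl X , ≤₁-refl X }
        ; sym   = swap
        ; trans = λ { {X , _} {Y , _} {Z , _} (p , p′) (q , q′) →
                      ≤₁-trans X Y Z p q , ≤₁-trans Z Y X q′ p′ }
        }
      ; reflexive = proj₁
      ; trans     = λ { {X , _} {Y , _} {Z , _} → ≤₁-trans X Y Z }
      }
    ; antisym = _,_
    }
  }

-- IsOrderMonomorphism asks that ≤ be both preserved and reflected.
ContainsCopyOf : ∀ {a b c d e f} → Poset a b c → Poset d e f →
                 Set (a ⊔ b ⊔ c ⊔ d ⊔ e ⊔ f)
ContainsCopyOf P Q =
  ∃[ φ ] IsOrderMonomorphism (Poset._≈_ Q) (Poset._≈_ P)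
                             (Poset._≤_ Q) (Poset._≤_ P) φ

ℚ-poset : Poset 0ℓ 0ℓ 0ℓ
ℚ-poset = DecTotalOrder.poset ≤-decTotalOrder

------------------------------------------------------------------------
-- Profile codings

-- ℚ ∩ (1,2); propositional equality here is equality of the underlying
-- rationals, as the bounds are irrelevant.
ℚ⟨1,2⟩ : Set
ℚ⟨1,2⟩ = [ p ∈ ℚ ∣ 1ℚ ℚ.< p × p ℚ.< + 2 ℚ./ 1 ]

Profile : Set
Profile = ℕ → ℚ⟨1,2⟩

blockStart : ℕ → ℕ
blockStart zero    = 0
blockStart (suc k) = blockStart k + k !

Block : ℕ → Subset
Block k x = blockStart k ≤ x × x < blockStart (suc k)

-- The set Cᵢ, with characteristic function A ∘ hᵢ, is the preimage h i ⊢ A.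
record ProfileCoding (u : ℕ → Profile) (D : Pred (ℕ × ℕ) 0ℓ)
                     (A : Subset) (h : ℕ → ℕ → ℕ) : Set where
  field
    constantOnBlocks : ∀ k {x y} → x ∈ Block k → y ∈ Block k → x ∈ A ⇔ y ∈ A
    fibres≤2         : ∀ i → FibresBounded (h i) 2
    bfoEquivalent    : ∀ i → (h i ⊢ A) ≡bfo A
    monotone         : ∀ i j → (∀ k → value (u i k) ℚ.≤ value (u j k)) →
                       (h i ⊢ A) ≤₁ (h j ⊢ A)
    diagonal         : ∀ i j → (i , j) ∈ D → ¬ ((h i ⊢ A) ≤₁ (h j ⊢ A))

{-# OPTIONS --safe #-}

-- The set h i ⊢ A repeats A(y) once or twice for each y, so that block k of A becomes a block
-- of about qᵢ k! elements; if qᵢ ≤ qⱼ, the former blocks embed into the latter. The set A is a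
-- union of blocks chosen by a ∅′-computable finite extension construction. If qᵢ > qⱼ and f is
-- injective, then for large k, as 0! + … + (k-1)! = o(k!), some x in block k of h i ⊢ A is
-- mapped by f beyond block k of h j ⊢ A. So a stage of the construction that leaves block k
-- out of A and puts the block reached by f into A prevents f from being a reduction. No
-- universal program is needed: the output of a program with given number is found by asking
-- ∅′, for v = 0, 1, …, whether the program "halt if that output is v" halts.
module Submission where

open import Defs
open import Level using (0ℓ)
open import Axiom.ExcludedMiddle using (ExcludedMiddle)
open import Data.Fin.Base using (Fin; toℕ; fromℕ<)
open import Data.Fin.Patterns using (0F; 1F; 2F)
import Data.Fin.Properties as Fin
import Data.Integer.Properties as ℤ
open import Data.List.Base using (List; []; _∷_; length)
open import Data.List.Relation.Unary.All as All using (All; []; _∷_)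
open import Data.List.Relation.Unary.AllPairs using ([]; _∷_)
open import Data.List.Relation.Unary.Unique.Propositional using (Unique)
open import Data.Nat.Base as ℕ using (ℕ; zero; suc; z≤n; s≤s)
import Data.Nat.Properties as ℕ
open import Data.Rational.Base as ℚ using (ℚ; mkℚ; 1ℚ; ↥_; ↧_; *<*)
import Data.Rational.Properties as ℚ
open import Data.Rational.Unnormalised.Base as ℚᵘ using (mkℚᵘ)
import Data.Rational.Unnormalised.Properties as ℚᵘ
open import Data.Product.Base using (∃-syntax; Σ-syntax; _×_; _,_; proj₁; proj₂)
open import Data.Refinement.Base using (value; _,_)
open import Data.Sum.Base using (_⊎_; inj₁; inj₂)
open import Data.Vec.Base using (Vec; []; _∷_; lookup)
open import Data.Vec.Relation.Binary.Pointwise.Inductive using (Pointwise; []; _∷_)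
open import Function.Base using (_∘_)
open import Function.Bundles using (_⇔_; mk⇔; Equivalence)
open import Function.Definitions using (Bijective; Injective; Surjective)
open import Relation.Nullary using (¬_; yes; no; contradiction; recompute)
open import Relation.Unary using (∅; _∈_; _∉_; _⊢_)
open import Relation.Binary.Definitions using (tri<; tri≈; tri>)
open import Relation.Binary.PropositionalEquality hiding ([_])

module BlockCoding where

  open import Data.Nat.Base
  open import Data.Nat.Properties
  open import Data.Nat.Tactic.RingSolver using (solve-∀)

  private
    variable
      m n : ℕ
      X : Subset

  -- Programs have at most one output

  χ-functional : ∀ {x v w} → χ X x v → χ X x w → v ≡ w
  χ-functional (member _)      (member _)      = refl
  χ-functional (member x∈X)    (nonmember x∉X) = contradiction x∈X x∉X
  χ-functional (nonmember x∉X) (member x∈X)    = contradiction x∈X x∉X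
  χ-functional (nonmember _)   (nonmember _)   = refl

  mutual
    Eval-functional : ∀ {c : Code n} {xs v w} → Eval X c xs v → Eval X c xs w → v ≡ w
    Eval-functional zer            zer             = refl
    Eval-functional succ           succ            = refl
    Eval-functional (oracle p)     (oracle q)      = χ-functional p q
    Eval-functional (proj i)       (proj .i)       = refl
    Eval-functional (comp ps p)    (comp qs q)
      with refl ← Evals-functional ps qs           = Eval-functional p q
    Eval-functional (prec-zero p)  (prec-zero q)   = Eval-functional p q
    Eval-functional (prec-suc p r) (prec-suc q s)
      with refl ← Eval-functional p q              = Eval-functional r s
    Eval-functional (mini {k = k} below p) (mini {k = l} below′ q) with <-cmp k l
    ... | tri< k<l _ _ with () ← Eval-functional p (proj₂ (below′ k<l))
    ... | tri≈ _ k≡l _ = k≡l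
    ... | tri> _ _ l<k with () ← Eval-functional (proj₂ (below l<k)) q

    Evals-functional : ∀ {gs : Vec (Code n) m} {xs vs ws} →
                       Pointwise (λ g y → Eval X g xs y) gs vs →
                       Pointwise (λ g y → Eval X g xs y) gs ws → vs ≡ ws
    Evals-functional []       []       = refl
    Evals-functional (p ∷ ps) (q ∷ qs) = cong₂ _∷_ (Eval-functional p q) (Evals-functional ps qs)

  -- Injectivity of the numbering of programs

  -- A remainder of at most `s` does not carry `s * s` to the next square, so a pair determines its
  -- sum `a + b`.
  square-gap : ∀ {s t b c} → s < t → b ≤ s → s * s + b < t * t + c
  square-gap {s} {t} {b} {c} s<t b≤s = begin-strict
    s * s + b  ≤⟨ +-monoʳ-≤ (s * s) b≤s ⟩
    s * s + s  ≡⟨ +-comm (s * s) s ⟩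
    suc s * s  <⟨ *-monoʳ-< (suc s) (n<1+n s) ⟩
    suc s * suc s ≤⟨ *-mono-≤ s<t s<t ⟩
    t * t      ≤⟨ m≤m+n (t * t) c ⟩
    t * t + c  ∎
    where open ≤-Reasoning

  pair-injective : ∀ {a b c d} → pair a b ≡ pair c d → a ≡ c × b ≡ d
  pair-injective {a} {b} {c} {d} eq with <-cmp (a + b) (c + d)
  ... | tri< lt _ _ = contradiction eq (<⇒≢ (square-gap lt (m≤n+m b a)))
  ... | tri> _ _ gt = contradiction (sym eq) (<⇒≢ (square-gap gt (m≤n+m d c)))
  ... | tri≈ _ s≡t _ = +-cancelʳ-≡ b a c (trans s≡t (cong (c +_) (sym b≡d))) , b≡d
    where
    b≡d : b ≡ d
    b≡d = +-cancelˡ-≡ ((a + b) * (a + b)) b d (trans eq (cong (λ s → s * s + d) (sym s≡t)))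

  pairˡ : ∀ {a b c d} → pair a b ≡ pair c d → a ≡ c
  pairˡ {a} {b} {c} {d} eq = proj₁ (pair-injective {a} {b} {c} {d} eq)

  pairʳ : ∀ {a b c d} → pair a b ≡ pair c d → b ≡ d
  pairʳ {a} {b} {c} {d} eq = proj₂ (pair-injective {a} {b} {c} {d} eq)

  -- Comparing tags first disposes of all pairs of programs with different outermost constructors.
  tag : Code n → ℕ
  tag zer        = 0
  tag succ       = 1
  tag oracle     = 2
  tag (proj _)   = 3
  tag (comp _ _) = 4
  tag (prec _ _) = 5
  tag (mini _)   = 6

  payload : Code n → ℕ
  payload zer            = 0
  payload succ           = 0
  payload oracle         = 0
  payload (proj i)       = toℕ i
  payload (comp {m} f gs) = pair m (pair ⌜ f ⌝ ⌜ gs ⌝*)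
  payload (prec f g)     = pair ⌜ f ⌝ ⌜ g ⌝
  payload (mini f)       = ⌜ f ⌝

  ⌜⌝≡pair : (c : Code n) → ⌜ c ⌝ ≡ pair (tag c) (payload c)
  ⌜⌝≡pair zer        = refl
  ⌜⌝≡pair succ       = refl
  ⌜⌝≡pair oracle     = refl
  ⌜⌝≡pair (proj _)   = refl
  ⌜⌝≡pair (comp _ _) = refl
  ⌜⌝≡pair (prec _ _) = refl
  ⌜⌝≡pair (mini _)   = refl

  mutual
    ⌜⌝-injective : (c d : Code n) → ⌜ c ⌝ ≡ ⌜ d ⌝ → c ≡ d
    ⌜⌝-injective c d eq =
      tagged c d (pairˡ {tag c} {_} {tag d} eq′) (pairʳ {tag c} {_} {tag d} eq′)
      where
      eq′ : pair (tag c) (payload c) ≡ pair (tag d) (payload d)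
      eq′ = trans (sym (⌜⌝≡pair c)) (trans eq (⌜⌝≡pair d))

    tagged : (c d : Code n) → tag c ≡ tag d → payload c ≡ payload d → c ≡ d
    tagged zer      zer      _ _  = refl
    tagged succ     succ     _ _  = refl
    tagged oracle   oracle   _ _  = refl
    tagged (proj i) (proj j) _ eq = cong proj (Fin.toℕ-injective eq)
    tagged (comp {m} f gs) (comp {l} g hs) _ eq with pairˡ {m} {_} {l} eq
    ... | refl = cong₂ comp
      (⌜⌝-injective f g (pairˡ {⌜ f ⌝} {_} {⌜ g ⌝} (pairʳ {m} {_} {m} eq)))
      (⌜⌝*-injective gs hs (pairʳ {⌜ f ⌝} {_} {⌜ g ⌝} (pairʳ {m} {_} {m} eq)))
    tagged (prec f g) (prec f′ g′) _ eq = cong₂ prec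
      (⌜⌝-injective f f′ (pairˡ {⌜ f ⌝} {_} {⌜ f′ ⌝} eq))
      (⌜⌝-injective g g′ (pairʳ {⌜ f ⌝} {_} {⌜ f′ ⌝} eq))
    tagged (mini f) (mini g) _ eq = cong mini (⌜⌝-injective f g eq)

    ⌜⌝*-injective : (cs ds : Vec (Code n) m) → ⌜ cs ⌝* ≡ ⌜ ds ⌝* → cs ≡ ds
    ⌜⌝*-injective []       []       _  = refl
    ⌜⌝*-injective (c ∷ cs) (d ∷ ds) eq = cong₂ _∷_
      (⌜⌝-injective c d (pairˡ {⌜ c ⌝} {_} {⌜ d ⌝} (suc-injective eq)))
      (⌜⌝*-injective cs ds (pairʳ {⌜ c ⌝} {_} {⌜ d ⌝} (suc-injective eq)))

  -- Functions computable with an oracle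

  -- Functions take the whole input vector, so that programs can be composed like expressions in the
  -- variables `var i`.
  record Rec (X : Subset) (f : Vec ℕ n → ℕ) : Set where
    constructor _computedBy_
    field
      code    : Code n
      correct : ∀ xs → Eval X code xs (f xs)
  open Rec

  Rec₁ : Subset → (ℕ → ℕ) → Set
  Rec₁ X f = Σ[ c ∈ Code 1 ] ∀ x → Eval X c (x ∷ []) (f x)

  Rec₂ : Subset → (ℕ → ℕ → ℕ) → Set
  Rec₂ X f = Σ[ c ∈ Code 2 ] ∀ x y → Eval X c (x ∷ y ∷ []) (f x y)

  _≗computedBy_ : ∀ {f g : Vec ℕ n → ℕ} → g ≗ f → Rec X f → Rec X g
  eq ≗computedBy (c computedBy p) =
    c computedBy λ xs → subst (Eval _ c xs) (sym (eq xs)) (p xs)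

  var : (i : Fin n) → Rec X (λ xs → lookup xs i)
  var i = proj i computedBy λ _ → proj i

  constant : ℕ → Code n
  constant zero    = zer
  constant (suc k) = comp succ (constant k ∷ [])

  constant-correct : ∀ k (xs : Vec ℕ n) → Eval X (constant k) xs k
  constant-correct zero    xs = zer
  constant-correct (suc k) xs = comp (constant-correct k xs ∷ []) succ

  lit : ∀ k → Rec {n} X (λ _ → k)
  lit k = constant k computedBy constant-correct k

  app₁ : ∀ {g} {f : Vec ℕ n → ℕ} → Rec₁ X g → Rec X f → Rec X (λ xs → g (f xs))
  app₁ (c , p) (d computedBy q) = comp c (d ∷ []) computedBy λ xs → comp (q xs ∷ []) (p _)

  app₂ : ∀ {g} {f₁ f₂ : Vec ℕ n → ℕ} → Rec₂ X g → Rec X f₁ → Rec X f₂ →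
         Rec X (λ xs → g (f₁ xs) (f₂ xs))
  app₂ (c , p) (d₁ computedBy q₁) (d₂ computedBy q₂) =
    comp c (d₁ ∷ d₂ ∷ []) computedBy λ xs → comp (q₁ xs ∷ q₂ xs ∷ []) (p _ _)

  fun₁ : ∀ {f} → Rec {1} X f → Rec₁ X (λ x → f (x ∷ []))
  fun₁ (c computedBy p) = c , λ x → p _

  fun₂ : ∀ {f} → Rec {2} X f → Rec₂ X (λ x y → f (x ∷ y ∷ []))
  fun₂ (c computedBy p) = c , λ x y → p _

  flipped : ∀ {f} → Rec₂ X f → Rec₂ X (λ x y → f y x)
  flipped r = fun₂ (app₂ r (var 1F) (var 0F))

  partial₂ : ∀ {f} → Rec₂ X f → ∀ i → Rec₁ X (f i)
  partial₂ r i = fun₁ (app₂ r (lit i) (var 0F))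

  module _ {f : ℕ → Vec ℕ n → ℕ} {s : Vec ℕ (2 + n) → ℕ} where
    primrec : Rec X (f 0) → Rec X s → (∀ k xs → f (suc k) xs ≡ s (k ∷ f k xs ∷ xs)) →
              Σ[ c ∈ Code (suc n) ] ∀ k xs → Eval X c (k ∷ xs) (f k xs)
    primrec {X = X} (c computedBy p) (d computedBy q) step = prec c d , go
      where
      go : ∀ k xs → Eval X (prec c d) (k ∷ xs) (f k xs)
      go zero    xs = prec-zero (p xs)
      go (suc k) xs =
        prec-suc (go k xs) (subst (Eval X d _) (sym (step k xs)) (q _))

  primrec₁ : ∀ {f s} → Rec {2} X s → (∀ k → f (suc k) ≡ s (k ∷ f k ∷ [])) → Rec₁ X f
  primrec₁ {f = f} r step with primrec {f = λ k _ → f k} (lit (f 0)) r (λ { k [] → step k })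
  ... | c , p = c , λ x → p x []

  primrec₂ : ∀ {f s} → Rec₁ X (f 0) → Rec {3} X s →
             (∀ k x → f (suc k) x ≡ s (k ∷ f k x ∷ x ∷ [])) → Rec₂ X f
  primrec₂ {f = f} b r step
    with primrec {f = λ k xs → f k (lookup xs 0F)} (app₁ b (var 0F)) r (λ { k (x ∷ []) → step k x })
  ... | c , p = c , λ k x → p k (x ∷ [])

  suc-rec : Rec₁ X suc
  suc-rec = succ , λ _ → succ

  pred-rec : Rec₁ X pred
  pred-rec = primrec₁ (var 0F) λ _ → refl

  +-rec : Rec₂ X _+_
  +-rec = primrec₂ (fun₁ (var 0F)) (app₁ suc-rec (var 1F)) λ _ _ → refl

  *-rec : Rec₂ X _*_
  *-rec = primrec₂ (fun₁ (lit 0)) (app₂ +-rec (var 2F) (var 1F)) λ _ _ → refl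

  ∸-rec : Rec₂ X _∸_
  -- Subtraction iterates the predecessor, so the recursion runs over the subtrahend.
  ∸-rec = flipped (primrec₂ {f = λ n m → m ∸ n} (fun₁ (var 0F)) (app₁ pred-rec (var 1F))
                            λ n m → sym (pred[m∸n]≡m∸[1+n] m n))

  !-rec : Rec₁ X _!
  !-rec = primrec₁ (app₂ *-rec (app₁ suc-rec (var 0F)) (var 1F)) λ _ → refl

  pair-rec : Rec₂ X pair
  pair-rec = fun₂ (app₂ +-rec (app₂ *-rec s s) (var 1F))
    where s = app₂ +-rec (var 0F) (var 1F)

  blockStart-rec : Rec₁ X blockStart
  blockStart-rec = primrec₁ (app₂ +-rec (var 1F) (app₁ !-rec (var 0F))) λ _ → refl

  ∣-∣-split : ∀ a b → ∣ a - b ∣ ≡ (a ∸ b) + (b ∸ a)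
  ∣-∣-split zero    zero    = refl
  ∣-∣-split zero    (suc b) = refl
  ∣-∣-split (suc a) zero    = sym (+-identityʳ (suc a))
  ∣-∣-split (suc a) (suc b) = ∣-∣-split a b

  ∣-∣-rec : Rec₂ X ∣_-_∣
  ∣-∣-rec = fun₂ ((λ xs → ∣-∣-split (lookup xs 0F) (lookup xs 1F)) ≗computedBy
    app₂ +-rec (app₂ ∸-rec (var 0F) (var 1F)) (app₂ ∸-rec (var 1F) (var 0F)))

  abstract
    -- Comparisons as numerical truth values: `1 ∸ n` is 1 if `n` is 0, and 0 otherwise.
    [_≤_] : ℕ → ℕ → ℕ
    [ a ≤ b ] = 1 ∸ (a ∸ b)

    [≤]-rec : Rec₂ X [_≤_]
    [≤]-rec = fun₂ (app₂ ∸-rec (lit 1) (app₂ ∸-rec (var 0F) (var 1F)))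

    [≤]-yes : ∀ {a b} → a ≤ b → [ a ≤ b ] ≡ 1
    [≤]-yes a≤b = cong (1 ∸_) (m≤n⇒m∸n≡0 a≤b)

    [≤]-no : ∀ {a b} → b < a → [ a ≤ b ] ≡ 0
    [≤]-no b<a = m≤n⇒m∸n≡0 (m<n⇒0<n∸m b<a)

    [≤]≤1 : ∀ a b → [ a ≤ b ] ≤ 1
    [≤]≤1 a b = m∸n≤m 1 (a ∸ b)

    [_≡_] : ℕ → ℕ → ℕ
    [ a ≡ b ] = 1 ∸ ∣ a - b ∣

    [≡]-rec : Rec₂ X [_≡_]
    [≡]-rec = fun₂ (app₂ ∸-rec (lit 1) (app₂ ∣-∣-rec (var 0F) (var 1F)))

    [≡]-yes : ∀ {a b} → a ≡ b → [ a ≡ b ] ≡ 1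
    [≡]-yes a≡b = cong (1 ∸_) (m≡n⇒∣m-n∣≡0 a≡b)

    [≡]-no : ∀ {a b} → a ≢ b → [ a ≡ b ] ≡ 0
    [≡]-no a≢b = m≤n⇒m∸n≡0 (n≢0⇒n>0 (a≢b ∘ ∣m-n∣≡0⇒m≡n))

  -- Inverses of strictly increasing functions

  -- inv b x is the k with b k ≤ x < b (suc k), for strictly increasing b with b 0 ≡ 0.
  inv : (ℕ → ℕ) → ℕ → ℕ
  inv b zero    = zero
  inv b (suc x) = inv b x + [ b (suc (inv b x)) ≤ suc x ]

  inv-rec : ∀ {b} → Rec₂ X b → Rec₂ X (λ i → inv (b i))
  inv-rec {b = b} r = flipped (primrec₂ {f = λ x i → inv (b i) x} (fun₁ (lit 0))
    (app₂ +-rec (var 1F)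
                (app₂ [≤]-rec (app₂ r (var 2F) (app₁ suc-rec (var 1F))) (app₁ suc-rec (var 0F))))
    λ _ _ → refl)

  inv-rec₁ : ∀ {b} → Rec₁ X b → Rec₁ X (inv b)
  inv-rec₁ r = partial₂ (inv-rec {b = λ _ → _} (fun₂ (app₁ r (var 1F)))) 0

  module Inverse (b : ℕ → ℕ) (b-zero : b 0 ≡ 0) (b-suc : ∀ k → b k < b (suc k)) where

    b-mono : ∀ {k l} → k ≤ l → b k ≤ b l
    b-mono k≤l = go (≤⇒≤′ k≤l)
      where
      go : ∀ {k l} → k ≤′ l → b k ≤ b l
      go ≤′-refl       = ≤-refl
      go (≤′-step k≤l) = ≤-trans (go k≤l) (<⇒≤ (b-suc _))

    b-mono-< : ∀ {k l} → k < l → b k < b l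
    b-mono-< k<l = <-≤-trans (b-suc _) (b-mono k<l)

    b-injective : ∀ {k l} → b k ≡ b l → k ≡ l
    b-injective {k} {l} eq with <-cmp k l
    ... | tri< k<l _ _ = contradiction eq (<⇒≢ (b-mono-< k<l))
    ... | tri≈ _ k≡l _ = k≡l
    ... | tri> _ _ l<k = contradiction (sym eq) (<⇒≢ (b-mono-< l<k))

    k≤bk : ∀ k → k ≤ b k
    k≤bk zero    = z≤n
    k≤bk (suc k) = ≤-<-trans (k≤bk k) (b-suc k)

    -- As `b` is strictly increasing, the step from `x` to `suc x` passes at most one value of `b`,
    -- so one comparison per step suffices.
    inv-bounds : ∀ x → b (inv b x) ≤ x × x < b (suc (inv b x))
    inv-bounds zero    = ≤-reflexive b-zero , k≤bk 1
    inv-bounds (suc x) with inv-bounds x | b (suc (inv b x)) ≤? suc x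
    ... | lo , hi | yes le
      rewrite [≤]-yes le | +-comm (inv b x) 1 = le , ≤-<-trans hi (b-suc _)
    ... | lo , hi | no ≰
      rewrite [≤]-no (≰⇒> ≰) | +-identityʳ (inv b x) = m≤n⇒m≤1+n lo , ≰⇒> ≰

    lower : ∀ x → b (inv b x) ≤ x
    lower x = proj₁ (inv-bounds x)

    upper : ∀ x → x < b (suc (inv b x))
    upper x = proj₂ (inv-bounds x)

    inv-≥ : ∀ {k x} → b k ≤ x → k ≤ inv b x
    inv-≥ {k} {x} bk≤x =
      ≮⇒≥ λ inv<k → <-irrefl refl (<-≤-trans (upper x) (≤-trans (b-mono inv<k) bk≤x))

    inv-< : ∀ {k x} → x < b k → inv b x < k
    inv-< {k} {x} x<bk =
      ≰⇒> λ k≤inv → <-irrefl refl (<-≤-trans x<bk (≤-trans (b-mono k≤inv) (lower x)))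

    inv-unique : ∀ {k x} → b k ≤ x → x < b (suc k) → inv b x ≡ k
    inv-unique lo hi = ≤-antisym (≤-pred (inv-< hi)) (inv-≥ lo)

    inv-b : ∀ k → inv b (b k) ≡ k
    inv-b k = inv-unique ≤-refl (b-suc k)

  -- Unbounded search

  -- `mini` requires positive values before the one it returns, so a known zero must be replaced by
  -- the first zero.
  least : ∀ (t : ℕ → ℕ) x → t x ≡ 0 → ∃[ k ] t k ≡ 0 × (∀ {j} → j < k → ∃[ v ] t j ≡ suc v)
  least t x tx≡0 with t 0 in eq
  least t x       tx≡0 | zero  = 0 , eq , λ ()
  least t zero    tx≡0 | suc v with () ← trans (sym eq) tx≡0
  least t (suc x) tx≡0 | suc v with least (t ∘ suc) x tx≡0
  ... | k , tk≡0 , below = suc k , tk≡0 , λ { {zero} _ → v , eq ; {suc j} (s≤s j<k) → below j<k }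

  mini-least : ∀ {n} {f : Vec ℕ (suc n) → ℕ} {xs} (r : Rec X f) {x} → f (x ∷ xs) ≡ 0 →
               ∃[ k ] Eval X (mini (code r)) xs k × f (k ∷ xs) ≡ 0
  mini-least {X = X} {f = f} {xs} (c computedBy p) {x} fx≡0
    with least (λ k → f (k ∷ xs)) x fx≡0
  ... | k , fk≡0 , below =
    k , mini (λ j<k → let v , eq = below j<k in v , subst (Eval X c _) eq (p _))
             (subst (Eval X c _) fk≡0 (p _)) , fk≡0

  abstract
    -- The test ignores the search variable: the search stops at 0 if the two inputs agree, and
    -- never otherwise.
    haltsIfEqual : Code 2
    haltsIfEqual = mini (code (app₂ {X = ∅} {f₁ = λ xs → lookup xs 1F} ∣-∣-rec (var 1F) (var 2F)))

    haltsIfEqual-halts : ∀ v → Eval ∅ haltsIfEqual (v ∷ v ∷ []) 0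
    haltsIfEqual-halts v = mini (λ ())
      (subst (Eval ∅ _ _) (m≡n⇒∣m-n∣≡0 {v} refl)
             (correct (app₂ ∣-∣-rec (var 1F) (var 2F)) (0 ∷ v ∷ v ∷ [])))

    haltsIfEqual-equal : ∀ {v w x} → Eval ∅ haltsIfEqual (v ∷ w ∷ []) x → v ≡ w
    haltsIfEqual-equal {v} {w} (mini _ p) = ∣m-n∣≡0⇒m≡n
      (Eval-functional (correct (app₂ ∣-∣-rec (var 1F) (var 2F)) (_ ∷ v ∷ w ∷ [])) p)

  -- Operations on program numbers, and padding

  abstract
    -- An opaque copy of `pair`, which keeps the numbers of programs symbolic.
    ⟨_,_⟩ : ℕ → ℕ → ℕ
    ⟨ a , b ⟩ = pair a b

    pair≡⟨⟩ : ∀ a b → pair a b ≡ ⟨ a , b ⟩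
    pair≡⟨⟩ a b = refl

    ≤⟨⟩ˡ : ∀ a b → a ≤ ⟨ a , b ⟩
    ≤⟨⟩ˡ zero    b = z≤n
    ≤⟨⟩ˡ (suc a) b = ≤-trans (m≤m+n (suc a) b)
      (≤-trans (m≤m*n (suc a + b) (suc a + b)) (m≤m+n _ b))

    ≤⟨⟩ʳ : ∀ a b → b ≤ ⟨ a , b ⟩
    ≤⟨⟩ʳ a b = m≤n+m b ((a + b) * (a + b))

    ⟨⟩-rec : Rec₂ X ⟨_,_⟩
    ⟨⟩-rec = pair-rec

  -- The suffix `#` marks what building a program does to numbers. A computation from ∅′ handles
  -- numbers only, and these need not be numbers of programs.
  comp# : ℕ → ℕ → ℕ → ℕ
  comp# m e ds = ⟨ 4 , ⟨ m , ⟨ e , ds ⟩ ⟩ ⟩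

  infixr 5 _∷#_
  _∷#_ : ℕ → ℕ → ℕ
  d ∷# ds = suc ⟨ d , ds ⟩

  constant# : ℕ → ℕ
  constant# zero    = ⟨ 0 , 0 ⟩
  constant# (suc k) = comp# 1 ⟨ 1 , 0 ⟩ (constant# k ∷# 0)

  fixInput# : ℕ → ℕ → ℕ
  fixInput# e k = comp# 1 e (constant# k ∷# 0)

  -- A case of the s-m-n theorem: the actual input is ignored. The jump only speaks of programs run
  -- on their own numbers, and this makes every other input accessible to it.
  fixInput : Code 1 → ℕ → Code 1
  fixInput c k = comp c (constant k ∷ [])

  -- Whatever its own input, this program halts just if `c` outputs `v` on input `⌜ c ⌝`; so
  -- membership of its number in ∅′ answers that question.
  returns : Code 1 → ℕ → Code 1
  returns c v = comp haltsIfEqual (constant v ∷ fixInput c ⌜ c ⌝ ∷ [])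

  returns# : ℕ → ℕ → ℕ
  returns# e v = comp# 2 ⌜ haltsIfEqual ⌝ (constant# v ∷# fixInput# e e ∷# 0)

  ⌜comp⌝ : ∀ {d ds} (f : Code m) (gs : Vec (Code n) m) →
           ⌜ f ⌝ ≡ d → ⌜ gs ⌝* ≡ ds → ⌜ comp f gs ⌝ ≡ comp# m d ds
  ⌜comp⌝ {m = m} f gs refl refl = trans (pair≡⟨⟩ 4 _) (cong ⟨ 4 ,_⟩
    (trans (pair≡⟨⟩ m _) (cong ⟨ m ,_⟩ (pair≡⟨⟩ ⌜ f ⌝ ⌜ gs ⌝*))))

  ⌜∷⌝ : ∀ {d ds} (g : Code n) (gs : Vec (Code n) m) →
        ⌜ g ⌝ ≡ d → ⌜ gs ⌝* ≡ ds → ⌜ g ∷ gs ⌝* ≡ d ∷# ds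
  ⌜∷⌝ g gs refl refl = cong suc (pair≡⟨⟩ ⌜ g ⌝ ⌜ gs ⌝*)

  ⌜constant⌝ : ∀ k → ⌜ constant {n} k ⌝ ≡ constant# k
  ⌜constant⌝ zero    = pair≡⟨⟩ 0 0
  ⌜constant⌝ (suc k) =
    ⌜comp⌝ succ (constant k ∷ []) (pair≡⟨⟩ 1 0) (⌜∷⌝ (constant k) [] (⌜constant⌝ k) refl)

  ⌜fixInput⌝ : ∀ c k → ⌜ fixInput c k ⌝ ≡ fixInput# ⌜ c ⌝ k
  ⌜fixInput⌝ c k = ⌜comp⌝ c (constant k ∷ []) refl (⌜∷⌝ (constant k) [] (⌜constant⌝ k) refl)

  ⌜returns⌝ : ∀ c v → ⌜ returns c v ⌝ ≡ returns# ⌜ c ⌝ v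
  ⌜returns⌝ c v = ⌜comp⌝ haltsIfEqual (constant v ∷ applied ∷ []) refl
    (⌜∷⌝ (constant v) (applied ∷ []) (⌜constant⌝ v)
      (⌜∷⌝ applied [] (⌜fixInput⌝ c ⌜ c ⌝) refl))
    where applied = fixInput c ⌜ c ⌝

  returns-halts : ∀ {c v} x → Eval ∅ c (⌜ c ⌝ ∷ []) v → Eval ∅ (returns c v) (x ∷ []) 0
  returns-halts {c} {v} x p =
    comp (constant-correct v _ ∷ comp (constant-correct ⌜ c ⌝ _ ∷ []) p ∷ []) (haltsIfEqual-halts v)

  returns-sound : ∀ {c v w x y} → Eval ∅ c (⌜ c ⌝ ∷ []) w → Eval ∅ (returns c v) (x ∷ []) y → v ≡ w
  returns-sound {c} {v} p (comp (a ∷ comp (b ∷ []) q ∷ []) r)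
    with refl ← Eval-functional a (constant-correct v _)
    with refl ← Eval-functional b (constant-correct ⌜ c ⌝ _)
    with refl ← Eval-functional p q = haltsIfEqual-equal r

  comp#-rec : ∀ {m} {f₁ f₂ : Vec ℕ n → ℕ} → Rec X f₁ → Rec X f₂ →
              Rec X (λ xs → comp# m (f₁ xs) (f₂ xs))
  comp#-rec r s = app₂ ⟨⟩-rec (lit 4) (app₂ ⟨⟩-rec (lit _) (app₂ ⟨⟩-rec r s))

  ∷#-rec : Rec₂ X _∷#_
  ∷#-rec = fun₂ (app₁ suc-rec (app₂ ⟨⟩-rec (var 0F) (var 1F)))

  constant#-rec : Rec₁ X constant#
  constant#-rec = primrec₁
    (comp#-rec (app₂ ⟨⟩-rec (lit 1) (lit 0)) (app₂ ∷#-rec (var 1F) (lit 0)))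
    λ _ → refl

  fixInput#-rec : Rec₂ X fixInput#
  fixInput#-rec = fun₂ (comp#-rec (var 0F) (app₂ ∷#-rec (app₁ constant#-rec (var 1F)) (lit 0)))

  returns#-rec : Rec₂ X returns#
  returns#-rec = fun₂ (comp#-rec (lit ⌜ haltsIfEqual ⌝)
    (app₂ ∷#-rec (app₁ constant#-rec (var 1F))
      (app₂ ∷#-rec (app₂ fixInput#-rec (var 0F) (var 0F)) (lit 0))))

  <⌜pad⌝ : (c d : Code 1) → ⌜ d ⌝ < ⌜ comp c (d ∷ []) ⌝
  <⌜pad⌝ c d = begin-strict
    ⌜ d ⌝                                ≤⟨ ≤⟨⟩ˡ ⌜ d ⌝ 0 ⟩
    ⟨ ⌜ d ⌝ , 0 ⟩                        <⟨ n<1+n _ ⟩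
    ⌜ d ⌝ ∷# 0                           ≤⟨ ≤⟨⟩ʳ ⌜ c ⌝ _ ⟩
    ⟨ ⌜ c ⌝ , ⌜ d ⌝ ∷# 0 ⟩               ≤⟨ ≤⟨⟩ʳ 1 _ ⟩
    ⟨ 1 , ⟨ ⌜ c ⌝ , ⌜ d ⌝ ∷# 0 ⟩ ⟩       ≤⟨ ≤⟨⟩ʳ 4 _ ⟩
    comp# 1 ⌜ c ⌝ (⌜ d ⌝ ∷# 0)           ≡⟨ ⌜comp⌝ c (d ∷ []) refl (⌜∷⌝ d [] refl refl) ⟨
    ⌜ comp c (d ∷ []) ⌝                  ∎
    where open ≤-Reasoning

  abstract
    -- Composing with the identity raises the number and keeps the outputs, so a program can be met
    -- at an arbitrarily late stage.
    padded : ∀ b (c : Code 1) →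
             ∃[ d ] b ≤ ⌜ d ⌝ × (∀ {xs v} → Eval ∅ c xs v → Eval ∅ d xs v)
    padded zero    c = c , z≤n , λ p → p
    padded (suc b) c with padded b c
    ... | d , b≤d , d-correct =
      comp (proj 0F) (d ∷ []) , ≤-<-trans b≤d (<⌜pad⌝ (proj 0F) d) ,
      λ p → comp (d-correct p ∷ []) (proj 0F)

  -- A program that searches for a jump beyond `k`

  module _ {s t : ℕ → ℕ} (s-rec : Computable s) (t-rec : Computable t) where

    -- On `x ∷ k ∷ []` this is 0 exactly if `s x ≡ k` and `k < t x`: both summands must vanish.
    jumpTest : Vec ℕ 2 → ℕ
    jumpTest xs = ∣ s (lookup xs 0F) - lookup xs 1F ∣ + (suc (lookup xs 1F) ∸ t (lookup xs 0F))

    jumpTest-rec : Rec ∅ jumpTest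
    jumpTest-rec = app₂ +-rec (app₂ ∣-∣-rec (app₁ s-rec (var 0F)) (var 1F))
                              (app₂ ∸-rec (app₁ suc-rec (var 1F)) (app₁ t-rec (var 0F)))

    jumpLength-rec : Rec {2} ∅ (λ xs → t (lookup xs 0F) ∸ suc (lookup xs 1F))
    jumpLength-rec = app₂ ∸-rec (app₁ t-rec (var 0F)) (app₁ suc-rec (var 1F))

    -- The output is the distance of `t x` from `suc k`, the form in which the recursion for `stage`
    -- uses it.
    jump : Code 1
    jump = comp (code jumpLength-rec) (mini (code jumpTest-rec) ∷ proj 0F ∷ [])

    jump-correct : ∀ {k} → (∃[ x ] s x ≡ k × k < t x) →
                   ∃[ x ] ∃[ v ] Eval ∅ jump (k ∷ []) v × s x ≡ k × t x ≡ suc (k + v)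
    jump-correct {k} (x , src , tgt)
      with mini-least {xs = k ∷ []} jumpTest-rec {x} (cong₂ _+_ (m≡n⇒∣m-n∣≡0 src) (m≤n⇒m∸n≡0 tgt))
    ... | y , halts , test≡0 =
      y , t y ∸ suc k , comp (halts ∷ proj 0F ∷ []) (correct jumpLength-rec (y ∷ k ∷ [])) ,
      ∣m-n∣≡0⇒m≡n (m+n≡0⇒m≡0 ∣ s y - k ∣ test≡0) ,
      sym (m+[n∸m]≡n (m∸n≡0⇒m≤n (m+n≡0⇒n≡0 ∣ s y - k ∣ test≡0)))

  block : ℕ → ℕ
  block = inv blockStart

  -- The set `A`, computed from ∅′

  module Construction (em : ExcludedMiddle 0ℓ) where

    halting : ℕ → ℕ
    halting e with em {(∅ ′) e}
    ... | yes _ = 1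
    ... | no  _ = 0

    halting-yes : ∀ {e} → e ∈ ∅ ′ → halting e ≡ 1
    halting-yes {e} p with em {(∅ ′) e}
    ... | yes _ = refl
    ... | no ¬p = contradiction p ¬p

    halting-no : ∀ {e} → e ∉ ∅ ′ → halting e ≡ 0
    halting-no {e} ¬p with em {(∅ ′) e}
    ... | yes p = contradiction p ¬p
    ... | no _  = refl

    halting-rec : Rec₁ (∅ ′) halting
    halting-rec = oracle , λ x → oracle (graph x)
      where
      graph : ∀ x → χ (∅ ′) x (halting x)
      graph x with em {(∅ ′) x}
      ... | yes p = member p
      ... | no ¬p = nonmember ¬p

    -- The input is `e` itself, as in the jump; 0 is the default for `e` outside ∅′.
    output : ℕ → ℕ
    output e with em {(∅ ′) e}
    ... | yes (_ , _ , v , _) = v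
    ... | no  _               = 0

    output-correct : ∀ {c v} → Eval ∅ c (⌜ c ⌝ ∷ []) v → output ⌜ c ⌝ ≡ v
    output-correct {c} {v} p with em {(∅ ′) ⌜ c ⌝}
    ... | no ¬p = contradiction (c , refl , v , p) ¬p
    ... | yes (d , eq , _ , q) with refl ← ⌜⌝-injective d c eq = Eval-functional q p

    -- Vanishes identically when program e diverges, so that the search for an output always halts.
    outputTest : ℕ → ℕ → ℕ
    outputTest v e = halting e * (1 ∸ halting (returns# e v))

    outputTest-zero : ∀ e → outputTest (output e) e ≡ 0
    outputTest-zero e with em {(∅ ′) e}
    ... | no  _ = refl
    ... | yes (c , refl , v , p) = cong (λ h → 1 ∸ h + 0) (halting-yes
      (returns c v , ⌜returns⌝ c v , 0 , returns-halts _ p))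

    outputTest-suc : ∀ e {v} → v < output e → outputTest v e ≡ 1
    outputTest-suc e {v} v<out with em {(∅ ′) e}
    ... | yes (c , refl , w , p) = cong (λ h → 1 ∸ h + 0) (halting-no
      λ { (d , eq , _ , q) →
          let d≡ = ⌜⌝-injective d (returns c v) (trans eq (sym (⌜returns⌝ c v))) in
          <⇒≢ v<out (returns-sound p (subst (λ d → Eval ∅ d _ _) d≡ q)) })

    outputTest-rec : Rec {2} (∅ ′) (λ xs → outputTest (lookup xs 0F) (lookup xs 1F))
    outputTest-rec = app₂ *-rec (app₁ halting-rec (var 1F))
      (app₂ ∸-rec (lit 1) (app₁ halting-rec (app₂ returns#-rec (var 1F) (var 0F))))

    -- If `e` is in ∅′, the first `v` confirmed by the oracle is the output, by determinism.
    -- Otherwise the search stops at 0, the default value of `output`.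
    output-rec : Rec₁ (∅ ′) output
    output-rec = mini (code outputTest-rec) , λ e → mini
      (λ j<out → 0 , subst (Eval (∅ ′) _ _) (outputTest-suc e j<out)
                               (correct outputTest-rec (_ ∷ e ∷ [])))
      (subst (Eval (∅ ′) _ _) (outputTest-zero e) (correct outputTest-rec (_ ∷ e ∷ [])))

    -- Stage n leaves block (stage n) out of A and puts block (stage (suc n) ∸ 1) into A,
    -- which the program numbered n, run on input stage n, may place arbitrarily far out.
    stage : ℕ → ℕ
    stage zero    = 0
    stage (suc n) = 2 + stage n + output (fixInput# n (stage n))

    stage-rec : Rec₁ (∅ ′) stage
    stage-rec = primrec₁
      (app₂ +-rec (app₂ +-rec (lit 2) (var 1F))
                  (app₁ output-rec (app₂ fixInput#-rec (var 0F) (var 1F))))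
      λ _ → refl

    -- The gap of at least 2 puts `suc (stage n)` strictly between two consecutive values of
    -- `stage`, which is why block `stage n` stays out of `A`.
    stage-suc : ∀ n → suc (stage n) < stage (suc n)
    stage-suc n = m≤m+n (2 + stage n) _

    module Stage = Inverse stage refl (λ n → <-trans (n<1+n _) (stage-suc n))

    -- suc (block x) is a value of stage.
    A : Subset
    A x = stage (inv stage (suc (block x))) ≡ suc (block x)

    indicator : ℕ → ℕ
    indicator x = [ stage (inv stage (suc (block x))) ≡ suc (block x) ]

    indicator-rec : Rec₁ (∅ ′) indicator
    indicator-rec = fun₁ (app₂ [≡]-rec (app₁ stage-rec (app₁ (inv-rec₁ stage-rec) l)) l)
      where l = app₁ suc-rec (app₁ (inv-rec₁ blockStart-rec) (var 0F))

    A≤∅′ : A ≤T (∅ ′)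
    A≤∅′ = proj₁ indicator-rec , λ χx → subst (Eval (∅ ′) _ _) (graph χx) (proj₂ indicator-rec _)
      where
      graph : ∀ {x v} → χ A x v → indicator x ≡ v
      graph (member x∈A)    = [≡]-yes x∈A
      graph (nonmember x∉A) = [≡]-no x∉A

    stage∉A : ∀ n x → block x ≡ stage n → x ∉ A
    stage∉A n x eq x∈A rewrite eq
      | Stage.inv-unique {n} (n≤1+n (stage n)) (stage-suc n) = contradiction (sym x∈A) 1+n≢n

    next∈A : ∀ n x → block x ≡ suc (stage n + output (fixInput# n (stage n))) → x ∈ A
    next∈A n x eq rewrite eq = cong stage (Stage.inv-b (suc n))

    A-block : ∀ x y → block x ≡ block y → x ∈ A ⇔ y ∈ A
    A-block x y eq = mk⇔ (subst P eq) (subst P (sym eq))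
      where P = λ k → stage (inv stage (suc k)) ≡ suc k

    output-fixInput : ∀ {c k v} → Eval ∅ c (k ∷ []) v → output (fixInput# ⌜ c ⌝ k) ≡ v
    output-fixInput {c} {k} p = trans (cong output (sym (⌜fixInput⌝ c k)))
      (output-correct {fixInput c k} (comp (constant-correct k _ ∷ []) p))

    -- The program k ↦ t x ∸ suc k, for the least x with s x ≡ k < t x, is run at the stage
    -- given by its own number.
    separates : ∀ {s t} → Computable s → Computable t → ∀ b →
                (∀ k → b ≤ k → ∃[ x ] s x ≡ k × k < t x) →
                ∃[ x ] (∀ y → block y ≡ s x → y ∉ A) × (∀ y → block y ≡ t x → y ∈ A)
    separates s-rec t-rec b jumps =
      -- Padding gives `b ≤ ⌜ c ⌝ ≤ stage ⌜ c ⌝`, so `jumps` applies to `k`, and the search at that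
      -- stage succeeds.
      let c , b≤c , c-correct = padded b (jump s-rec t-rec)
          k = stage ⌜ c ⌝
          x , v , halts , src , tgt =
            jump-correct s-rec t-rec (jumps k (≤-trans b≤c (Stage.k≤bk ⌜ c ⌝)))
          out≡v = output-fixInput {c} (c-correct halts)
      in x , (λ y eq → stage∉A ⌜ c ⌝ y (trans eq src)) ,
         λ y eq → next∈A ⌜ c ⌝ y (trans eq (trans tgt (cong (λ v → suc (k + v)) (sym out≡v))))

  -- Bounded fibres and the pigeonhole principle

  injective⇒fibres≤1 : ∀ {f} → Injective _≡_ _≡_ f → FibresBounded f 1
  injective⇒fibres≤1 f-inj y []          _ _ = z≤n
  injective⇒fibres≤1 f-inj y (_ ∷ [])    _ _ = s≤s z≤n
  injective⇒fibres≤1 f-inj y (_ ∷ _ ∷ _) ((x≢x′ ∷ _) ∷ _) (p ∷ q ∷ _) =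
    contradiction (f-inj (trans p (sym q))) x≢x′

  ≤₁⇒≤bfo : ∀ {A B} → A ≤₁ B → A ≤bfo B
  ≤₁⇒≤bfo (f , f-rec , f-inj , f-red) = f , f-rec , (1 , ≤-refl , injective⇒fibres≤1 f-inj) , f-red

  two-values : ∀ {w x} → w ≤ x → x < 2 + w → x ≡ w ⊎ x ≡ suc w
  two-values {w} {x} w≤x x<2+w with m≤n⇒m<n∨m≡n w≤x
  ... | inj₁ w<x = inj₂ (≤-antisym (≤-pred x<2+w) w<x)
  ... | inj₂ w≡x = inj₁ (sym w≡x)

  unique-two-values : ∀ {w} {xs : List ℕ} → Unique xs → All (λ x → x ≡ w ⊎ x ≡ suc w) xs →
                      length xs ≤ 2
  unique-two-values {xs = []}          _ _ = z≤n
  unique-two-values {xs = _ ∷ []}      _ _ = s≤s z≤n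
  unique-two-values {xs = _ ∷ _ ∷ []}  _ _ = ≤-refl
  unique-two-values {xs = _ ∷ _ ∷ _ ∷ _} ((a≢b ∷ a≢c ∷ _) ∷ (b≢c ∷ _) ∷ _) (p ∷ q ∷ r ∷ _)
    with p | q | r
  ... | inj₁ refl | inj₁ refl | _         = contradiction refl a≢b
  ... | inj₁ refl | _         | inj₁ refl = contradiction refl a≢c
  ... | _         | inj₁ refl | inj₁ refl = contradiction refl b≢c
  ... | inj₂ refl | inj₂ refl | _         = contradiction refl a≢b
  ... | inj₂ refl | _         | inj₂ refl = contradiction refl a≢c
  ... | _         | inj₂ refl | inj₂ refl = contradiction refl b≢c

  -- Otherwise the `l` inputs from `r` on would all have values below `M`, and two of them would
  -- collide.
  injective⇒exceeds : ∀ {f} → Injective _≡_ _≡_ f → ∀ r l M → M < l →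
                      ∃[ x ] r ≤ x × x < r + l × M ≤ f x
  injective⇒exceeds {f} f-inj r l M M<l with Fin.any? (λ (t : Fin l) → M ≤? f (r + toℕ t))
  ... | yes (t , M≤ft) = r + toℕ t , m≤m+n r _ , +-monoʳ-< r (Fin.toℕ<n t) , M≤ft
  ... | no none =
    let s , t , s<t , eq = Fin.pigeonhole M<l (λ t → fromℕ< (below t))
        fs≡ft = trans (sym (Fin.toℕ-fromℕ< (below s))) 
                    (trans (cong toℕ eq) (Fin.toℕ-fromℕ< (below t)))
    in contradiction (+-cancelˡ-≡ r _ _ (f-inj fs≡ft)) (<⇒≢ s<t)
    where
    below : ∀ t → f (r + toℕ t) < M
    below t = ≰⇒> λ M≤ft → none (t , M≤ft)

  -- Growth of the blocks

  blockStart-suc : ∀ k → blockStart k < blockStart (suc k)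
  blockStart-suc k = m<m+n (blockStart k) (1≤n! k)

  module Block = Inverse blockStart refl blockStart-suc

  Block⇒block : ∀ {k x} → x ∈ Block k → block x ≡ k
  Block⇒block (lo , hi) = Block.inv-unique lo hi

  -- The blocks before the last are together no longer than the last one: inductively they sum to at
  -- most `2 * suc k !`, which is at most `(2 + k) !`.
  blockStart≤2* : ∀ k → blockStart (suc k) ≤ 2 * k !
  blockStart≤2* zero          = s≤s z≤n
  blockStart≤2* (suc zero)    = ≤-refl
  blockStart≤2* (suc (suc k)) = begin
    blockStart (2 + k) + f   ≤⟨ +-monoˡ-≤ f (blockStart≤2* (suc k)) ⟩
    2 * suc k ! + f          ≤⟨ +-monoˡ-≤ f (*-monoˡ-≤ (suc k !) {2} {2 + k} (s≤s (s≤s z≤n))) ⟩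
    f + f                    ≡⟨ cong (f +_) (sym (+-identityʳ f)) ⟩
    2 * f                    ∎
    where
    open ≤-Reasoning
    f = (2 + k) !

  -- A quantitative form of 0! + ... + (k-1)! = o(k!). The 5 arises as 2 · 2 + 1: twice the bound
  -- `2 * k !` on the sum, and one more `k !` that absorbs the 1.
  blockStart-small : ∀ p k → 5 * p < k → p * (2 * blockStart k + 1) < k !
  blockStart-small p (suc k) 5p<k = begin-strict
    p * (2 * blockStart (suc k) + 1)
      ≤⟨ *-monoʳ-≤ p (+-mono-≤ (*-monoʳ-≤ 2 (blockStart≤2* k)) (1≤n! k)) ⟩
    p * (2 * (2 * k !) + k !)         ≡⟨ rearrange p (k !) ⟩
    5 * p * k !                       <⟨ *-monoˡ-< (k !) {{>-nonZero (1≤n! k)}} 5p<k ⟩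
    suc k * k !                       ∎
    where
    open ≤-Reasoning
    rearrange : ∀ p f → p * (2 * (2 * f) + f) ≡ 5 * p * f
    rearrange = solve-∀

  -- The functions `h i` and the reductions for increasing densities

  module Coding (num d : ℕ → ℕ) where

    den : ℕ → ℕ
    den i = suc (d i)

    infix 4 _≼_ _≺_
    _≼_ _≺_ : ℕ → ℕ → Set
    i ≼ j = num i * den j ≤ num j * den i
    i ≺ j = num i * den j < num j * den i

    -- The elements of block k at offsets t < (num i / den i - 1) · k! get two preimages under h i.
    doubledAt : ℕ → ℕ → ℕ → ℕ
    doubledAt i k t = [ suc ((t + k !) * den i) ≤ num i * k ! ]

    doubled : ℕ → ℕ → ℕ
    doubled i y = doubledAt i (block y) (y ∸ blockStart (block y))

    -- The least preimage of `y` under `h i`, which equals the number of preimages of all smaller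
    -- elements.
    first : ℕ → ℕ → ℕ
    first i zero    = 0
    first i (suc y) = suc (first i y + doubled i y)

    first-suc : ∀ i y → first i y < first i (suc y)
    first-suc i y = s≤s (m≤m+n _ _)

    module H (i : ℕ) = Inverse (first i) refl (first-suc i)

    h : ℕ → ℕ → ℕ
    h i = inv (first i)

    first-suc≤ : ∀ i y → first i (suc y) ≤ 2 + first i y
    first-suc≤ i y = s≤s (≤-trans (+-monoʳ-≤ (first i y) ([≤]≤1 _ _)) (≤-reflexive (+-comm _ 1)))

    first≤2* : ∀ i y → first i y ≤ 2 * y
    first≤2* i zero    = z≤n
    first≤2* i (suc y) = ≤-trans (first-suc≤ i y)
      (≤-trans (+-monoʳ-≤ 2 (first≤2* i y)) (≤-reflexive (sym (*-suc 2 y))))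

    -- Doubling means that `t + k !` is below `num / den` times `k !`, a threshold that grows with
    -- the quotient.
    doubledAt-mono : ∀ {i j} → i ≼ j → ∀ k t → doubledAt i k t ≤ doubledAt j k t
    doubledAt-mono {i} {j} i≼j k t with suc ((t + k !) * den i) ≤? num i * k !
    ... | no ≰ rewrite [≤]-no (≰⇒> ≰) = z≤n
    ... | yes lt = ≤-trans ([≤]≤1 _ _) (≤-reflexive (sym ([≤]-yes
      (*-cancelʳ-< (den i) ((t + k !) * den j) (num j * k !) (begin-strict
        (t + k !) * den j * den i ≡⟨ swapʳ (t + k !) (den j) (den i) ⟩
        (t + k !) * den i * den j <⟨ *-monoˡ-< (den j) lt ⟩
        num i * k ! * den j       ≡⟨ swapʳ (num i) (k !) (den j) ⟩
        num i * den j * k !       ≤⟨ *-monoˡ-≤ (k !) i≼j ⟩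
        num j * den i * k !       ≡⟨ swapʳ (num j) (den i) (k !) ⟩
        num j * k ! * den i       ∎)))))
      where
      open ≤-Reasoning
      swapʳ : ∀ a b c → a * b * c ≡ a * c * b
      swapʳ = solve-∀

    h-first : ∀ i y → h i (first i y) ≡ y
    h-first i y = H.inv-b i y

    h-surjective : ∀ i → Surjective _≡_ _≡_ (h i)
    h-surjective i y = first i y , λ { refl → h-first i y }

    h-fibres : ∀ i → FibresBounded (h i) 2
    h-fibres i y xs unique all = unique-two-values {first i y} unique (All.map
      (λ { {x} refl →
        two-values (H.lower i x) (<-≤-trans (H.upper i x) (first-suc≤ i (h i x))) }) all)

    -- The part of h i ⊢ A over y embeds into the part of h j ⊢ A over y, offset by offset.
    shift : ℕ → ℕ → ℕ → ℕ
    shift i j x = first j (h i x) + (x ∸ first i (h i x))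

    -- The offset of `x` over `y` is at most `doubled i y`, hence at most `doubled j y`, so the
    -- shifted element is still over `y`.
    h-shift : ∀ {i j} → i ≼ j → ∀ x → h j (shift i j x) ≡ h i x
    h-shift {i} {j} i≼j x = H.inv-unique j (m≤m+n _ _) (s≤s (+-monoʳ-≤ (first j y) (begin
      x ∸ first i y                     ≤⟨ ∸-monoˡ-≤ (first i y) (≤-pred (H.upper i x)) ⟩
      first i y + doubled i y ∸ first i y ≡⟨ m+n∸m≡n (first i y) _ ⟩
      doubled i y
        ≤⟨ doubledAt-mono {i} {j} i≼j (block y) (y ∸ blockStart (block y)) ⟩
      doubled j y                       ∎)))
      where
      open ≤-Reasoning
      y = h i x

    -- Applying `h j` to the image recovers `h i x`, and then the offset determines `x`.
    shift-injective : ∀ {i j} → i ≼ j → Injective _≡_ _≡_ (shift i j)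
    shift-injective {i} {j} i≼j {x} {x′} eq = ∸-cancelʳ-≡ (H.lower i x) (below x′ (sym y≡y′))
      (+-cancelˡ-≡ (first j (h i x)) _ _
        (trans eq (cong (λ y → first j y + (x′ ∸ first i y)) (sym y≡y′))))
      where
      y≡y′ : h i x ≡ h i x′
      y≡y′ = trans (sym (h-shift i≼j x)) (trans (cong (h j) eq) (h-shift i≼j x′))
      below : ∀ x′ {y} → h i x′ ≡ y → first i y ≤ x′
      below x′ refl = H.lower i x′

    -- Lengths of the blocks after doubling

    count : ℕ → ℕ → ℕ → ℕ
    count i k zero    = 0
    count i k (suc t) = count i k t + doubledAt i k t

    count≤ : ∀ i k t → count i k t ≤ t
    count≤ i k zero    = z≤n
    count≤ i k (suc t) =
      ≤-trans (+-mono-≤ (count≤ i k t) ([≤]≤1 _ _)) (≤-reflexive (+-comm t 1))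

    -- Rounding costs at most one element, hence the summand `den i`: if offset `t` passes the test,
    -- then `t + k !` is below the threshold, while at most `t` earlier offsets have been counted.
    count-upper : ∀ i → den i < num i → ∀ k t → (k ! + count i k t) * den i ≤ num i * k ! + den i
    count-upper i 1<q k zero = begin
      (k ! + 0) * den i    ≡⟨ cong (_* den i) (+-identityʳ (k !)) ⟩
      k ! * den i          ≡⟨ *-comm (k !) (den i) ⟩
      den i * k !          ≤⟨ *-monoˡ-≤ (k !) (<⇒≤ 1<q) ⟩
      num i * k !          ≤⟨ m≤m+n _ (den i) ⟩
      num i * k ! + den i  ∎
      where open ≤-Reasoning
    count-upper i 1<q k (suc t) with suc ((t + k !) * den i) ≤? num i * k !
    ... | no ≰ rewrite [≤]-no (≰⇒> ≰) | +-identityʳ (count i k t) = count-upper i 1<q k t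
    ... | yes lt rewrite [≤]-yes lt = begin
      (k ! + (count i k t + 1)) * den i
        ≤⟨ *-monoˡ-≤ (den i) (+-monoʳ-≤ (k !) (+-monoˡ-≤ 1 (count≤ i k t))) ⟩
      (k ! + (t + 1)) * den i            ≡⟨ rearrange (k !) t (den i) ⟩
      (t + k !) * den i + den i          ≤⟨ +-monoˡ-≤ (den i) (<⇒≤ lt) ⟩
      num i * k ! + den i                ∎
      where
      open ≤-Reasoning
      rearrange : ∀ f t e → (f + (t + 1)) * e ≡ (t + f) * e + e
      rearrange = solve-∀

    -- While all offsets pass the test, the count equals `t`. The first failure says that the
    -- threshold is reached, and this persists since the count never decreases.
    count-lower′ : ∀ i k t → count i k t ≡ t ⊎ num i * k ! ≤ (k ! + count i k t) * den i
    count-lower′ i k zero    = inj₁ refl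
    count-lower′ i k (suc t) with count-lower′ i k t
    ... | inj₂ le =
      inj₂ (≤-trans le (*-monoˡ-≤ (den i) (+-monoʳ-≤ (k !) (m≤m+n (count i k t) _))))
    ... | inj₁ eq with suc ((t + k !) * den i) ≤? num i * k !
    ...   | yes lt rewrite [≤]-yes lt | eq = inj₁ (+-comm t 1)
    ...   | no ≰ rewrite [≤]-no (≰⇒> ≰) | +-identityʳ (count i k t) | eq | +-comm (k !) t =
      inj₂ (≤-pred (≰⇒> ≰))

    count-lower : ∀ i → num i < 2 * den i → ∀ k → num i * k ! ≤ (k ! + count i k (k !)) * den i
    count-lower i q<2 k with count-lower′ i k (k !)
    ... | inj₂ le = le
    -- If the whole block is doubled, its length `2 * k !` suffices because the quotient is below 2.
    ... | inj₁ eq rewrite eq = begin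
      num i * k !           ≤⟨ *-monoˡ-≤ (k !) (<⇒≤ q<2) ⟩
      2 * den i * k !       ≡⟨ rearrange (den i) (k !) ⟩
      (k ! + k !) * den i   ∎
      where
      open ≤-Reasoning
      rearrange : ∀ e f → 2 * e * f ≡ (f + f) * e
      rearrange = solve-∀

    first-offset : ∀ i k t → t ≤ k ! →
                   first i (blockStart k + t) ≡ first i (blockStart k) + (t + count i k t)
    first-offset i k zero    _ rewrite +-identityʳ (blockStart k) = sym (+-identityʳ _)
    first-offset i k (suc t) t<k! rewrite +-suc (blockStart k) t
      | Block.inv-unique {k} (m≤m+n (blockStart k) t) (+-monoʳ-< (blockStart k) t<k!)
      | m+n∸m≡n (blockStart k) t
      | first-offset i k t (<⇒≤ t<k!) =
      rearrange (first i (blockStart k)) t (count i k t) (doubledAt i k t)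
      where
      rearrange : ∀ a t c e → suc (a + (t + c) + e) ≡ a + (suc t + (c + e))
      rearrange = solve-∀

    size : ℕ → ℕ → ℕ
    size i k = k ! + count i k (k !)

    first-nextBlock : ∀ i k → first i (blockStart (suc k)) ≡ first i (blockStart k) + size i k
    first-nextBlock i k = first-offset i k (k !) ≤-refl

    module _ (1<q : ∀ i → den i < num i) (q<2 : ∀ i → num i < 2 * den i) where

      -- Over the common denominator `p`, the integers `num i * den j` and `num j * den i` differ by
      -- at least 1, so the main terms differ by at least `k !`. This outweighs the earlier blocks
      -- and the rounding error.
      size-gap : ∀ {i j} → j ≺ i → ∀ k → 5 * (den i * den j) < k →
                 2 * blockStart k + size j k < size i k
      size-gap {i} {j} j≺i k large = ≰⇒> λ si≤ → <-irrefl refl (begin-strict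
        f + num j * den i * f                       ≡⟨⟩
        suc (num j * den i) * f                     ≤⟨ *-monoˡ-≤ f j≺i ⟩
        num i * den j * f                           ≡⟨ e₁ (num i) (den j) f ⟩
        num i * f * den j                           ≤⟨ *-monoˡ-≤ (den j) (count-lower i (q<2 i) k) ⟩
        si * den i * den j                          ≤⟨ *-monoˡ-≤ (den j) (*-monoˡ-≤ (den i) si≤) ⟩
        (2 * a + sj) * den i * den j                ≡⟨ e₂ (2 * a) sj (den i) (den j) ⟩
        2 * a * p + sj * den j * den i
          ≤⟨ +-monoʳ-≤ (2 * a * p) (*-monoˡ-≤ (den i) (count-upper j (1<q j) k f)) ⟩
        2 * a * p + (num j * f + den j) * den i     ≡⟨ e₃ (2 * a) (num j) f (den i) (den j) ⟩
        p * (2 * a + 1) + num j * den i * f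
          <⟨ +-monoˡ-< (num j * den i * f) (blockStart-small p k large) ⟩
        f + num j * den i * f                       ∎)
        where
        open ≤-Reasoning
        f = k !
        a = blockStart k
        p = den i * den j
        si = size i k
        sj = size j k
        e₁ : ∀ x y z → x * y * z ≡ x * z * y
        e₁ = solve-∀
        e₂ : ∀ b s x y → (b + s) * x * y ≡ b * (x * y) + s * y * x
        e₂ = solve-∀
        e₃ : ∀ b n f x y → b * (x * y) + (n * f + y) * x ≡ x * y * (b + 1) + n * x * f
        e₃ = solve-∀

      -- By counting, f cannot map the part of h i ⊢ A over block k into the part of
      -- h j ⊢ A over the blocks up to k.
      escapes : ∀ {i j f} → j ≺ i → Injective _≡_ _≡_ f → ∀ k → 5 * (den i * den j) < k →
                ∃[ x ] block (h i x) ≡ k × k < block (h j (f x))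
      escapes {i} {j} {f} j≺i f-inj k large =
        let x , lo , hi , M≤fx = injective⇒exceeds f-inj (first i a) (size i k) (first j a′) fits
            hi′ = subst (x <_) (sym (first-nextBlock i k)) hi
        in x , Block.inv-unique (H.inv-≥ i lo) (H.inv-< i hi′) , Block.inv-≥ (H.inv-≥ j M≤fx)
        where
        a = blockStart k
        a′ = blockStart (suc k)
        fits : first j a′ < size i k
        fits = begin-strict
          first j a′               ≡⟨ first-nextBlock j k ⟩
          first j a + size j k     ≤⟨ +-monoˡ-≤ (size j k) (first≤2* j a) ⟩
          2 * a + size j k         <⟨ size-gap j≺i k large ⟩
          size i k                 ∎
          where open ≤-Reasoning

    -- Computability of the reductions

    module _ (num-rec : Computable num) (d-rec : Computable d) where

      den-rec : Computable den
      den-rec = fun₁ (app₁ suc-rec (app₁ d-rec (var 0F)))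

      block-rec : Computable block
      block-rec = inv-rec₁ blockStart-rec

      doubled-rec : Computable₂ doubled
      doubled-rec = fun₂ (app₂ [≤]-rec
          (app₁ suc-rec (app₂ *-rec
            (app₂ +-rec (app₂ ∸-rec (var 1F) (app₁ blockStart-rec k)) (app₁ !-rec k))
            (app₁ den-rec (var 0F))))
          (app₂ *-rec (app₁ num-rec (var 0F)) (app₁ !-rec k)))
        where k = app₁ block-rec (var 1F)

      first-rec : Computable₂ first
      first-rec = flipped (primrec₂ {f = λ y i → first i y} (fun₁ (lit 0))
        (app₁ suc-rec (app₂ +-rec (var 1F) (app₂ doubled-rec (var 2F) (var 0F)))) λ _ _ → refl)

      h-rec : Computable₂ h
      h-rec = inv-rec first-rec

      shift-rec : ∀ i j → Computable (shift i j)
      shift-rec i j = fun₁ (app₂ +-rec (app₁ (partial₂ first-rec j) y)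
          (app₂ ∸-rec (var 0F) (app₁ (partial₂ first-rec i) y)))
        where y = app₁ (partial₂ h-rec i) (var 0F)

      module _ (A : Subset) where

        ≼⇒≤₁ : ∀ {i j} → i ≼ j → (h i ⊢ A) ≤₁ (h j ⊢ A)
        ≼⇒≤₁ {i} {j} i≼j = shift i j , shift-rec i j , shift-injective i≼j ,
          λ x → mk⇔ (subst A (sym (h-shift i≼j x))) (subst A (h-shift i≼j x))

        -- `h i` reduces its preimage of `A` to `A`; in the other direction its injective right
        -- inverse `first i` is a reduction.
        h⊢A≡A : ∀ i → (h i ⊢ A) ≡bfo A
        h⊢A≡A i =
          (h i , partial₂ h-rec i , (2 , s≤s z≤n , h-fibres i) , λ x → mk⇔ (λ p → p) (λ p → p)) ,
          ≤₁⇒≤bfo {A} {h i ⊢ A} (first i , partial₂ first-rec i , H.b-injective i ,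
            λ y → mk⇔ (subst A (sym (h-first i y))) (subst A (h-first i y)))

      -- Diagonalisation against injective reductions

      module Diagonal (em : ExcludedMiddle 0ℓ)
                      (1<q : ∀ i → den i < num i) (q<2 : ∀ i → num i < 2 * den i) where

        open Construction em

        ≺⇒≰₁ : ∀ {i j} → j ≺ i → ¬ ((h i ⊢ A) ≤₁ (h j ⊢ A))
        ≺⇒≰₁ {i} {j} j≺i (f , f-rec , f-inj , f-red) =
          let x , out , into = separates
                (fun₁ (app₁ block-rec (app₁ (partial₂ h-rec i) (var 0F))))
                (fun₁ (app₁ block-rec (app₁ (partial₂ h-rec j) (app₁ f-rec (var 0F)))))
                -- The successor turns the strict bound required by `escapes` into a weak one.
                (suc (5 * (den i * den j)))
                (escapes 1<q q<2 {i} {j} j≺i f-inj)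
          in out (h i x) refl (Equivalence.from (f-red x) (into (h j (f x)) refl))

-- Comparison of fractions

open BlockCoding
open import Data.Integer.Base as ℤ using (ℤ; +_; -[1+_]; -1ℤ; ∣_∣; +<+; -<+; +≤+)
open import Data.Integer.Tactic.RingSolver using (solve-∀)
open import Data.Irrelevant using ([_])
open import Data.Rational.Base using (_<_; _>_)

fraction : ℤ → ℕ → ℚ
fraction a d = a ℚ./ suc d

-- `fraction` reduces to lowest terms; among unnormalised rationals the order is
-- cross-multiplication itself.
fraction-<⇒ : ∀ a d b e → fraction a d < fraction b e → a ℤ.* + suc e ℤ.< b ℤ.* + suc d
fraction-<⇒ a d b e lt = ℚᵘ.drop-*<*
  (ℚᵘ.<-respˡ-≃ (ℚ.toℚᵘ-fromℚᵘ (mkℚᵘ a d))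
    (ℚᵘ.<-respʳ-≃ (ℚ.toℚᵘ-fromℚᵘ (mkℚᵘ b e)) (ℚ.toℚᵘ-mono-< lt)))

fraction-<⇐ : ∀ a d b e → a ℤ.* + suc e ℤ.< b ℤ.* + suc d → fraction a d < fraction b e
fraction-<⇐ a d b e lt = ℚ.toℚᵘ-cancel-<
  (ℚᵘ.<-respˡ-≃ (ℚᵘ.≃-sym (ℚ.toℚᵘ-fromℚᵘ (mkℚᵘ a d)))
    (ℚᵘ.<-respʳ-≃ (ℚᵘ.≃-sym (ℚ.toℚᵘ-fromℚᵘ (mkℚᵘ b e))) (ℚᵘ.*<* lt)))

+-fraction-< : ∀ m d n e → (fraction (+ m) d < fraction (+ n) e) ⇔ (m ℕ.* suc e ℕ.< n ℕ.* suc d)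
+-fraction-< m d n e = mk⇔
  (λ lt → ℤ.drop‿+<+
    (subst₂ ℤ._<_ (sym (ℤ.pos-* m (suc e))) (sym (ℤ.pos-* n (suc d)))
      (fraction-<⇒ (+ m) d (+ n) e lt)))
  (λ lt → fraction-<⇐ (+ m) d (+ n) e
    (subst₂ ℤ._<_ (ℤ.pos-* m (suc e)) (ℤ.pos-* n (suc d)) (+<+ lt)))

∣-1^s∣≡1 : ∀ s → ∣ -1ℤ ℤ.^ s ∣ ≡ 1
∣-1^s∣≡1 zero    = refl
∣-1^s∣≡1 (suc s) = trans (ℤ.abs-* -1ℤ (-1ℤ ℤ.^ s)) (trans (ℕ.+-identityʳ _) (∣-1^s∣≡1 s))

-- A nonnegative integer is its own absolute value, and the sign factor has absolute value 1.
unsigned : ∀ s n → + 0 ℤ.≤ (-1ℤ ℤ.^ s) ℤ.* + n → (-1ℤ ℤ.^ s) ℤ.* + n ≡ + n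
unsigned s n 0≤ = trans (sym (ℤ.0≤i⇒+∣i∣≡i 0≤)) (cong +_ (begin
  ∣ (-1ℤ ℤ.^ s) ℤ.* + n ∣    ≡⟨ ℤ.abs-* (-1ℤ ℤ.^ s) (+ n) ⟩
  ∣ -1ℤ ℤ.^ s ∣ ℕ.* n        ≡⟨ cong (ℕ._* n) (∣-1^s∣≡1 s) ⟩
  1 ℕ.* n                    ≡⟨ ℕ.*-identityˡ n ⟩
  n                          ∎))
  where open ≡-Reasoning

-- The irrelevant bound is recovered by deciding the inequality.
1<value : (r : ℚ⟨1,2⟩) → 1ℚ < value r
1<value (p , [ bounds ]) = recompute (1ℚ ℚ.<? p) (proj₁ bounds)

value<2 : (r : ℚ⟨1,2⟩) → value r < + 2 ℚ./ 1
value<2 (p , [ bounds ]) = recompute (p ℚ.<? (+ 2 ℚ./ 1)) (proj₂ bounds)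

-- An order embedding of ℚ into the interval (1,2)

-- squeeze p = 3/2 + p / (2 (1 + ∣p∣)).
module Squeeze where

  k : ℚ → ℕ
  k (mkℚ n d _) = d ℕ.+ ∣ n ∣

  -- The denominator of `p` times 1 + ∣p∣, so that p / (1 + ∣p∣) is `↥ p` over `D p`.
  D : ℚ → ℤ
  D p = + suc (k p)

  scaled : ℚ → ℤ
  scaled p = + 3 ℤ.* D p ℤ.+ ↥ p

  squeeze : ℚ → ℚ
  squeeze p = fraction (scaled p) (k p ℕ.+ suc (k p))

  -- For equal signs the two sides agree; for `m` negative and `n` not, 0 lies between them; the
  -- remaining case contradicts the hypothesis.
  cross : ∀ m n {d e} → m ℤ.* + e ℤ.< n ℤ.* + suc d → m ℤ.* + ∣ n ∣ ℤ.≤ n ℤ.* + ∣ m ∣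
  cross (+ a)    (+ b)    _ = ℤ.≤-reflexive (ℤ.*-comm (+ a) (+ b))
  cross -[1+ a ] -[1+ b ] _ = ℤ.≤-reflexive (begin
    -[1+ a ] ℤ.* + suc b      ≡⟨ ℤ.neg-distribˡ-* (+ suc a) (+ suc b) ⟨
    ℤ.- (+ suc a ℤ.* + suc b) ≡⟨ cong ℤ.-_ (ℤ.*-comm (+ suc a) (+ suc b)) ⟩
    ℤ.- (+ suc b ℤ.* + suc a) ≡⟨ ℤ.neg-distribˡ-* (+ suc b) (+ suc a) ⟩
    -[1+ b ] ℤ.* + suc a      ∎)
    where open ≡-Reasoning
  cross -[1+ a ] (+ b)    _ = ℤ.≤-trans
    (subst (ℤ._≤ + 0) (ℤ.neg-distribˡ-* (+ suc a) (+ b))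
      (subst (λ i → ℤ.- i ℤ.≤ + 0) (ℤ.pos-* (suc a) b) ℤ.neg-≤-pos))
    (subst (+ 0 ℤ.≤_) (ℤ.pos-* b (suc a)) (+≤+ z≤n))
  cross (+ a)    -[1+ b ] {d} {e} lt = contradiction
    (subst (ℤ._< -[1+ b ] ℤ.* + suc d) (sym (ℤ.pos-* a e)) lt) λ ()

  squeeze-mono-< : ∀ {p q} → p < q → squeeze p < squeeze q
  squeeze-mono-< {p@record{}} {q@record{}} (*<* p<q) =
    fraction-<⇐ (scaled p) _ (scaled q) _ (begin-strict
    (+ 3 ℤ.* D p ℤ.+ ↥ p) ℤ.* (D q ℤ.+ D q)      ≡⟨ expand (D p) (D q) (↥ p) ⟩
    + 6 ℤ.* (D p ℤ.* D q) ℤ.+ + 2 ℤ.* (↥ p ℤ.* D q)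
      <⟨ ℤ.+-monoʳ-< (+ 6 ℤ.* (D p ℤ.* D q)) (ℤ.*-monoˡ-<-pos (+ 2) core) ⟩
    + 6 ℤ.* (D p ℤ.* D q) ℤ.+ + 2 ℤ.* (↥ q ℤ.* D p)
      ≡⟨ cong (λ z → + 6 ℤ.* z ℤ.+ + 2 ℤ.* (↥ q ℤ.* D p)) (ℤ.*-comm (D p) (D q)) ⟩
    + 6 ℤ.* (D q ℤ.* D p) ℤ.+ + 2 ℤ.* (↥ q ℤ.* D p) ≡⟨ expand (D q) (D p) (↥ q) ⟨
    (+ 3 ℤ.* D q ℤ.+ ↥ q) ℤ.* (D p ℤ.+ D p)      ∎)
    where
    open ℤ.≤-Reasoning
    expand : ∀ x y n → (+ 3 ℤ.* x ℤ.+ n) ℤ.* (y ℤ.+ y) ≡ + 6 ℤ.* (x ℤ.* y) ℤ.+ + 2 ℤ.* (n ℤ.* y)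
    expand = solve-∀
    -- This says p / (1 + ∣p∣) < q / (1 + ∣q∣): the denominators contribute `p<q`, the absolute
    -- values `cross`.
    core : ↥ p ℤ.* D q ℤ.< ↥ q ℤ.* D p
    core = begin-strict
      ↥ p ℤ.* (↧ q ℤ.+ + ∣ ↥ q ∣)                 ≡⟨ ℤ.*-distribˡ-+ (↥ p) (↧ q) (+ ∣ ↥ q ∣) ⟩
      ↥ p ℤ.* ↧ q ℤ.+ ↥ p ℤ.* + ∣ ↥ q ∣           <⟨ ℤ.+-mono-<-≤ p<q (cross (↥ p) (↥ q) p<q) ⟩
      ↥ q ℤ.* ↧ p ℤ.+ ↥ q ℤ.* + ∣ ↥ p ∣           ≡⟨ ℤ.*-distribˡ-+ (↥ q) (↧ p) (+ ∣ ↥ p ∣) ⟨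
      ↥ q ℤ.* (↧ p ℤ.+ + ∣ ↥ p ∣)                 ∎

  -D<↥ : ∀ p → ℤ.- D p ℤ.< ↥ p
  -D<↥ (mkℚ (+ n)    d _) = -<+
  -D<↥ (mkℚ -[1+ n ] d _) = ℤ.-<- (ℕ.m≤n+m (suc n) d)

  ↥<D : ∀ p → ↥ p ℤ.< D p
  ↥<D (mkℚ (+ n)    d _) = +<+ (s≤s (ℕ.m≤n+m n d))
  ↥<D (mkℚ -[1+ n ] d _) = -<+

  1<squeeze : ∀ p → 1ℚ < squeeze p
  1<squeeze p = fraction-<⇐ (+ 1) 0 (scaled p) _ (begin-strict
    + 1 ℤ.* (D p ℤ.+ D p)            ≡⟨ e₁ (D p) ⟩
    + 3 ℤ.* D p ℤ.+ ℤ.- D p          <⟨ ℤ.+-monoʳ-< (+ 3 ℤ.* D p) (-D<↥ p) ⟩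
    + 3 ℤ.* D p ℤ.+ ↥ p              ≡⟨ ℤ.*-identityʳ _ ⟨
    (+ 3 ℤ.* D p ℤ.+ ↥ p) ℤ.* + 1    ∎)
    where
    open ℤ.≤-Reasoning
    e₁ : ∀ x → + 1 ℤ.* (x ℤ.+ x) ≡ + 3 ℤ.* x ℤ.+ ℤ.- x
    e₁ = solve-∀

  squeeze<2 : ∀ p → squeeze p < + 2 ℚ./ 1
  squeeze<2 p = fraction-<⇐ (scaled p) _ (+ 2) 0 (begin-strict
    (+ 3 ℤ.* D p ℤ.+ ↥ p) ℤ.* + 1    ≡⟨ ℤ.*-identityʳ _ ⟩
    + 3 ℤ.* D p ℤ.+ ↥ p              <⟨ ℤ.+-monoʳ-< (+ 3 ℤ.* D p) (↥<D p) ⟩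
    + 3 ℤ.* D p ℤ.+ D p              ≡⟨ e₁ (D p) ⟩
    + 2 ℤ.* (D p ℤ.+ D p)            ∎)
    where
    open ℤ.≤-Reasoning
    e₁ : ∀ x → + 3 ℤ.* x ℤ.+ x ≡ + 2 ℤ.* (x ℤ.+ x)
    e₁ = solve-∀

  into⟨1,2⟩ : ℚ → ℚ⟨1,2⟩
  into⟨1,2⟩ p = squeeze p , [ (1<squeeze p , squeeze<2 p) ]

mono-<⇒mono-≤ : ∀ {f : ℚ → ℚ} → (∀ {p r} → p < r → f p < f r) → ∀ {p r} → p ℚ.≤ r → f p ℚ.≤ f r
mono-<⇒mono-≤ {f} f-mono {p} {r} p≤r with r ℚ.≤? p
... | no r≰p  = ℚ.<⇒≤ (f-mono (ℚ.≰⇒> r≰p))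
... | yes r≤p = ℚ.≤-reflexive (cong f (ℚ.≤-antisym p≤r r≤p))

-- Numerators and denominators of the enumerated rationals

module Numerators (q : ℕ → ℚ⟨1,2⟩) (s num d : ℕ → ℕ)
  (q≡ : ∀ i → value (q i) ≡ ((-1ℤ ℤ.^ s i) ℤ.* + num i) ℚ./ suc (d i)) where

  open Coding num d

  q≡num/den : ∀ i → value (q i) ≡ fraction (+ num i) (d i)
  q≡num/den i = trans (q≡ i) (cong (λ a → fraction a (d i)) (unsigned (s i) (num i) (ℤ.<⇒≤
    (ℤ.<-trans (+<+ (s≤s z≤n))
      (subst (+ 1 ℤ.* + den i ℤ.<_) (ℤ.*-identityʳ ((-1ℤ ℤ.^ s i) ℤ.* + num i))
      (fraction-<⇒ (+ 1) 0 ((-1ℤ ℤ.^ s i) ℤ.* + num i) (d i)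
        (subst (1ℚ <_) (q≡ i) (1<value (q i)))))))))

  1<q : ∀ i → den i ℕ.< num i
  1<q i = subst₂ ℕ._<_ (ℕ.*-identityˡ (den i)) (ℕ.*-identityʳ (num i))
    (Equivalence.to (+-fraction-< 1 0 (num i) (d i)) (subst (1ℚ <_) (q≡num/den i) (1<value (q i))))

  q<2 : ∀ i → num i ℕ.< 2 ℕ.* den i
  q<2 i = subst (ℕ._< 2 ℕ.* den i) (ℕ.*-identityʳ (num i))
    (Equivalence.to (+-fraction-< (num i) (d i) 2 0)
      (subst (_< + 2 ℚ./ 1) (q≡num/den i) (value<2 (q i))))

  ≺⇔< : ∀ i j → (i ≺ j) ⇔ (value (q i) < value (q j))
  ≺⇔< i j = mk⇔
    (subst₂ _<_ (sym (q≡num/den i)) (sym (q≡num/den j)) ∘ Equivalence.from cross-multiplied)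
    (Equivalence.to cross-multiplied ∘ subst₂ _<_ (q≡num/den i) (q≡num/den j))
    where cross-multiplied = +-fraction-< (num i) (d i) (num j) (d j)

-- The copy of ℚ among the 1-degrees

module OrderEmbedding (em : ExcludedMiddle 0ℓ)
  (q : ℕ → ℚ⟨1,2⟩) (q-surjective : Surjective _≡_ _≡_ q)
  (s num d : ℕ → ℕ) (num-rec : Computable num) (d-rec : Computable d)
  (q≡ : ∀ i → value (q i) ≡ ((-1ℤ ℤ.^ s i) ℤ.* + num i) ℚ./ suc (d i)) where

  open Construction em
  open Coding num d
  open Squeeze
  open Numerators q s num d q≡
  open Diagonal num-rec d-rec em 1<q q<2

  bfo : ∀ i → (h i ⊢ A) ≡bfo A
  bfo = h⊢A≡A num-rec d-rec A

  mono : ∀ i j → value (q i) ℚ.≤ value (q j) → (h i ⊢ A) ≤₁ (h j ⊢ A)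
  mono i j qi≤qj = ≼⇒≤₁ num-rec d-rec A {i} {j} (ℕ.≮⇒≥ λ j≺i →
    ℚ.<-irrefl refl (ℚ.<-≤-trans (Equivalence.to (≺⇔< j i) j≺i) qi≤qj))

  anti : ∀ i j → value (q j) < value (q i) → ¬ ((h i ⊢ A) ≤₁ (h j ⊢ A))
  anti i j qj<qi = ≺⇒≰₁ {i} {j} (Equivalence.from (≺⇔< j i) qj<qi)

  -- Surjectivity of `q` provides an index for the squeezed rational; the embedding sends `p` to the
  -- set with this index.
  index : ℚ → ℕ
  index p = proj₁ (q-surjective (into⟨1,2⟩ p))

  value-index : ∀ p → value (q (index p)) ≡ squeeze p
  value-index p = cong value (proj₂ (q-surjective (into⟨1,2⟩ p)) refl)

  index-mono-< : ∀ {p r} → p < r → value (q (index p)) < value (q (index r))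
  index-mono-< {p} {r} p<r =
    subst₂ _<_ (sym (value-index p)) (sym (value-index r)) (squeeze-mono-< p<r)

  copy-cancel : ∀ p r → (h (index p) ⊢ A) ≤₁ (h (index r) ⊢ A) → p ℚ.≤ r
  copy-cancel p r X≤Y = ℚ.≮⇒≥ λ r<p → anti (index p) (index r) (index-mono-< r<p) X≤Y

  copy-mono : ∀ p r → p ℚ.≤ r → (h (index p) ⊢ A) ≤₁ (h (index r) ⊢ A)
  copy-mono p r p≤r = mono (index p) (index r) (mono-<⇒mono-≤ index-mono-< p≤r)

corollary3p4 : ExcludedMiddle 0ℓ →
    (q : ℕ → ℚ⟨1,2⟩) → Bijective _≡_ _≡_ q → Computableℚ (value ∘ q) →
    Σ[ A ∈ Subset ] ∃[ h ]
    A ≤T (∅ ′) ×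
    Computable₂ h ×
    (∀ i → Surjective _≡_ _≡_ (h i)) ×
    ProfileCoding (λ i k → q i) (λ (i , j) → value (q i) > value (q j)) A h ×
    (∀ i → (h i ⊢ A) ≡bfo A) ×
    (∀ i j → ((h i ⊢ A) <₁ (h j ⊢ A)) ⇔ (value (q i) < value (q j))) ×
    ContainsCopyOf (OneDegreesIn A) ℚ-poset
corollary3p4 em q (_ , q-surjective) (s , num , d , _ , num-rec , d-rec , q≡) =
  A , h , A≤∅′ , h-rec num-rec d-rec , h-surjective ,
  record
    { constantOnBlocks = λ k {x} {y} x∈ y∈ →
        A-block x y (trans (Block⇒block {k} x∈) (sym (Block⇒block {k} y∈)))
    ; fibres≤2         = h-fibres
    ; bfoEquivalent    = bfo
    -- The profiles are constant, so their values at 0 already compare the rationals.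
    ; monotone         = λ i j qi≤qj → mono i j (qi≤qj 0)
    ; diagonal         = anti
    } ,
  bfo ,
  -- By `mono`, the failure of the reverse reduction refutes `value (q j) ≤ value (q i)`, and the
  -- order of ℚ is total.
  (λ i j → mk⇔ (λ (Ci≤Cj , Cj≰Ci) → ℚ.≰⇒> (Cj≰Ci ∘ mono j i))
               (λ qi<qj → mono i j (ℚ.<⇒≤ qi<qj) , anti j i qi<qj)) ,
  (λ p → h (index p) ⊢ A , bfo (index p)) ,
  record
    { isOrderHomomorphism = record
      { cong = λ { {p} refl → ≤₁-refl (h (index p) ⊢ A) , ≤₁-refl (h (index p) ⊢ A) }
      ; mono = λ {p} {r} → copy-mono p r
      }
    ; injective = λ {p} {r} (X≤Y , Y≤X) →
        ℚ.≤-antisym (copy-cancel p r X≤Y) (copy-cancel r p Y≤X)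
    ; cancel    = λ {p} {r} → copy-cancel p r
    }
  where
  open Construction em
  open Coding num d
  open OrderEmbedding em q q-surjective s num d num-rec d-rec q≡
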